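{- There is an absolute constant $c>0$ such that the following holds. Let $G$ be a $(p,\beta)$-jumbled graph of order $n$, where $p=p(n)$ and $\beta=\beta(n)$ satisfy $\beta=o(np)$ as $n\to\infty$. Then, for $n$ sufficiently large, $G$ contains a minor with average degree at least $c\,n\sqrt{p}$.
   Context: All graphs are finite, simple. For $X\subseteq V(G)$, $e(X)$ is the number of edges of $G$ with both ends in $X$. A graph $G=(V,E)$ is $(p,\beta)$-jumbled if $\left|e(X)-p|X|^2/2\right|\le\beta|X|$ for every $X\subseteq V$. A graph $\Gamma$ is a minor of $G$ if there are vertex-disjoint connected subgraphs $G_u\subseteq G$, $u\in V(\Gamma)$, with an edge of $G$ between $G_u$ and $G_{u'}$ whenever $uu'\in E(\Gamma)$. $f=o(g)$ means $f(n)/g(n)\to 0$ as $n\to\infty$.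
   Formalization: The values p(n) and β(n) are taken to be rational numbers rather than real numbers; the bound "average degree at least c n √p" is stated in the equivalent squared form. -}

module Defs where

open import Data.Nat as ℕ using (ℕ; zero; suc; _<ᵇ_)
open import Data.Fin using (Fin; toℕ; zero; suc)
open import Data.Bool using (Bool; true; false; _∧_; if_then_else_)
open import Data.Maybe using (Maybe; just)
open import Data.Product using (Σ; ∃; ∃-syntax; _×_; _,_)
open import Data.Integer using (+_)
open import Data.Rational using (ℚ; _/_; _+_; _*_; _-_; ∣_∣; _≤_; _<_; 0ℚ)
open import Relation.Binary.PropositionalEquality using (_≡_)

record Graph (n : ℕ) : Set where
  field
    adj    : Fin n → Fin n → Bool
    sym    : ∀ i j → adj i j ≡ adj j i
    irrefl : ∀ i → adj i i ≡ false
open Graph public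

sumFin : (n : ℕ) → (Fin n → ℕ) → ℕ
sumFin zero    f = 0
sumFin (suc n) f = f zero ℕ.+ sumFin n (λ i → f (suc i))

Subset : ℕ → Set
Subset n = Fin n → Bool

size : {n : ℕ} → Subset n → ℕ
size {n} X = sumFin n (λ i → if X i then 1 else 0)

eIn : {n : ℕ} → Graph n → Subset n → ℕ
eIn {n} G X = sumFin n (λ i → sumFin n (λ j →
  if X i ∧ X j ∧ adj G i j ∧ (toℕ i <ᵇ toℕ j) then 1 else 0))

eAll : {n : ℕ} → Graph n → ℕ
eAll G = eIn G (λ _ → true)

ℕtoℚ : ℕ → ℚ
ℕtoℚ m = + m / 1

Jumbled : {n : ℕ} → Graph n → ℚ → ℚ → Set
Jumbled {n} G p β = ∀ (X : Subset n) →
  ∣ ℕtoℚ (eIn G X) - p * ℕtoℚ (size X) * ℕtoℚ (size X) * (+ 1 / 2) ∣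
    ≤ β * ℕtoℚ (size X)

data WalkIn {n : ℕ} (G : Graph n) (S : Subset n) : Fin n → Fin n → Set where
  here : ∀ {x} → S x ≡ true → WalkIn G S x x
  step : ∀ {x y z} → S x ≡ true → adj G x y ≡ true → WalkIn G S y z → WalkIn G S x z

ConnectedIn : {n : ℕ} → Graph n → Subset n → Set
ConnectedIn {n} G S =
  (∃[ x ] S x ≡ true) × (∀ x y → S x ≡ true → S y ≡ true → WalkIn G S x y)

record IsMinorOf {k n : ℕ} (Γ : Graph k) (G : Graph n) : Set where
  field
    B         : Fin k → Subset n
    connected : ∀ u → ConnectedIn G (B u)
    disjoint  : ∀ u u' x → B u x ≡ true → B u' x ≡ true → u ≡ u'
    edges     : ∀ u u' → adj Γ u u' ≡ true →
                ∃[ x ] ∃[ y ] (B u x ≡ true × B u' y ≡ true × adj G x y ≡ true)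

-- G has a minor with average degree at least c·n·√p.  Average degree of Γ on
-- k ≥ 1 vertices is 2e(Γ)/k ≥ 0; for p ≥ 0 the inequality 2e(Γ)/k ≥ c n √p
-- (with c > 0) is equivalent to (2e(Γ))² ≥ c² n² p k², which is stated here.
HasDenseMinor : {n : ℕ} → Graph n → ℚ → ℚ → Set
HasDenseMinor {n} G c p =
  ∃[ k ] ∃[ Γ ] (Σ (IsMinorOf {k} Γ G) λ _ →
    (0 ℕ.< k) ×
    (c * c * ℕtoℚ n * ℕtoℚ n * p * ℕtoℚ k * ℕtoℚ k
      ≤ ℕtoℚ (2 ℕ.* eAll Γ) * ℕtoℚ (2 ℕ.* eAll Γ)))

LittleO : (ℕ → ℚ) → (ℕ → ℚ) → Set
LittleO β p = ∀ (ε : ℚ) → 0ℚ < ε → ∃[ N ] ∀ n → N ℕ.≤ n →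
  ∣ β n ∣ ≤ ε * ∣ ℕtoℚ n * p n ∣

{-# OPTIONS --safe #-}

-- Fix a small constant ε with β ≤ ε n p and let s ≈ 1/√p.  Random walks of s steps serve as
-- branch sets.  Small vertex sets have large edge boundary in a jumbled graph (after deleting a
-- few vertices of high degree and a maximal sparse set), so a random walk of s steps meets a
-- given set N with |N| = O(n/s) with probability at least a constant times s|N|/n.  This
-- follows from a level set argument for the hitting probabilities and needs no spectral gap.
-- Taking m ≈ c n/s such walks one after the other, first choose disjoint
-- connected sets B₁,…,Bₘ with |N(Bᵢ)| of order s n p = n/s, then connected sets C₁,…,Cₘ
-- disjoint from them and from each other, each meeting a constant proportion of the N(Bᵢ).
-- Contracting all 2m sets gives average degree of order m ≈ c n √p.

module Submission where

open import Defs renaming (sym to adj-sym; irrefl to adj-irrefl)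
open import Data.Bool as Bool using (Bool; true; false; _∧_; _∨_; not; if_then_else_)
open import Data.Bool.Properties using (∨-comm)
open import Data.Fin as Fin using (Fin; zero; suc; toℕ; splitAt; _↑ˡ_; _↑ʳ_)
open import Data.Fin.Properties using (toℕ-injective; all?; splitAt-↑ˡ; splitAt-↑ʳ; toℕ-↑ˡ; toℕ-↑ʳ; toℕ<n)
open import Data.Integer as ℤ using (-[1+_])
import Data.Integer.Properties as ℤ
open import Data.Nat
open import Data.Nat.DivMod using (m/n*n≤m; m≡m%n+[m/n]*n; m%n<n; m≥n⇒m/n>0)
open import Data.Nat.Properties
open import Data.Nat.Tactic.RingSolver using (solve-∀)
open import Data.Product
open import Data.Rational as ℚ using (ℚ; mkℚ; 0ℚ; 1ℚ; ½; toℚᵘ)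
import Data.Rational.Properties as ℚ
open import Data.Rational.Solver using (module +-*-Solver)
open import Data.Rational.Unnormalised as ℚᵘ using (mkℚᵘ; *≡*; *≤*)
import Data.Rational.Unnormalised.Properties as ℚᵘ
open import Data.Sum using (_⊎_; inj₁; inj₂; [_,_]′)
open import Data.Unit using (tt)
open import Function using (_∘_)
open import Relation.Binary.PropositionalEquality
open import Relation.Nullary
open import Relation.Nullary.Decidable using (_×-dec_; _→-dec_)

-- Finite sums and subsets

-- A jumbled graph may have isolated vertices and poorly attached small sets, so only cuts inside a
-- pruned vertex set `W` are controlled. Deleting used vertices can create new sparse sets; hence
-- `W` is recomputed for every walk. Writing p = a/b and counting weighted walks instead of taking
-- probabilities keeps the argument in natural numbers until the final conversion.
--
-- The hitting bound is a dichotomy at each time. Either much weight flows out of the target, and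
-- the total count of successful walks increases accordingly; or little does, and the count is at
-- least half its maximum on a constant proportion of `W`, so the total is large already.
--
-- Both phases use this bound. In the first, the targets are neighbourhoods N(y) of single vertices:
-- |N(B)| is the number of y whose N(y) meets B. In the second, the used vertices could swallow the
-- sets N(Bᵢ). But O(n/h) vertices lie outside `W` and span O(p n²/h²) edges, while the N(Bᵢ) have
-- total size of order at least p n²/(c h), so a large h/c bounds the loss by half. This fixes the
-- order of constants: L = 10, c = 4 L (2 L + 1), h = 80 c, E = 12 h.

χ : Bool → ℕ
χ b = if b then 1 else 0

sum-cong : ∀ {n} {f g : Fin n → ℕ} → (∀ i → f i ≡ g i) → sumFin n f ≡ sumFin n g
sum-cong {zero}  e = refl
sum-cong {suc n} e = cong₂ _+_ (e zero) (sum-cong (e ∘ suc))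

sum-mono : ∀ {n} {f g : Fin n → ℕ} → (∀ i → f i ≤ g i) → sumFin n f ≤ sumFin n g
sum-mono {zero}  e = z≤n
sum-mono {suc n} e = +-mono-≤ (e zero) (sum-mono (e ∘ suc))

sum-zero : ∀ n → sumFin n (λ _ → 0) ≡ 0
sum-zero zero    = refl
sum-zero (suc n) = sum-zero n

interchange : ∀ a b c d → (a + b) + (c + d) ≡ (a + c) + (b + d)
interchange = solve-∀

sum-+ : ∀ {n} (f g : Fin n → ℕ) → sumFin n (λ i → f i + g i) ≡ sumFin n f + sumFin n g
sum-+ {zero}  f g = refl
sum-+ {suc n} f g = trans (cong (f zero + g zero +_) (sum-+ (f ∘ suc) (g ∘ suc)))
  (interchange (f zero) (g zero) _ _)

sum-*ˡ : ∀ {n} c (f : Fin n → ℕ) → sumFin n (λ i → c * f i) ≡ c * sumFin n f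
sum-*ˡ {zero}  c f = sym (*-zeroʳ c)
sum-*ˡ {suc n} c f = trans (cong (c * f zero +_) (sum-*ˡ c (f ∘ suc)))
  (sym (*-distribˡ-+ c (f zero) _))

sum-*ʳ : ∀ {n} c (f : Fin n → ℕ) → sumFin n (λ i → f i * c) ≡ sumFin n f * c
sum-*ʳ c f = trans (sum-cong (λ i → *-comm (f i) c)) (trans (sum-*ˡ c f) (*-comm c _))

sum-swap : ∀ {m n} (F : Fin m → Fin n → ℕ) →
  sumFin m (λ i → sumFin n (F i)) ≡ sumFin n (λ j → sumFin m (λ i → F i j))
sum-swap {zero}  {n} F = sym (sum-zero n)
sum-swap {suc m} F = trans (cong (sumFin _ (F zero) +_) (sum-swap (F ∘ suc)))
  (sym (sum-+ (F zero) _))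

sum-split : ∀ m {n} (f : Fin (m + n) → ℕ) →
  sumFin (m + n) f ≡ sumFin m (λ i → f (i ↑ˡ n)) + sumFin n (λ j → f (m ↑ʳ j))
sum-split zero    f = refl
sum-split (suc m) f = trans (cong (f zero +_) (sum-split m (f ∘ suc)))
  (sym (+-assoc (f zero) _ _))

term≤sum : ∀ {n} (f : Fin n → ℕ) i → f i ≤ sumFin n f
term≤sum f zero    = m≤m+n _ _
term≤sum f (suc i) = ≤-trans (term≤sum (f ∘ suc) i) (m≤n+m _ _)

sum-one : ∀ n → sumFin n (λ _ → 1) ≡ n
sum-one zero    = refl
sum-one (suc n) = cong suc (sum-one n)

-- This replaces averaging over random choices: some value is at least the weighted mean. The index
-- must have positive weight, since only then is it a possible step of a walk.
weighted-pick : ∀ {n} (w g : Fin n → ℕ) → 0 < sumFin n w →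
  ∃[ i ] (0 < w i × sumFin n (λ j → w j * g j) ≤ sumFin n w * g i)
weighted-pick {zero}  w g ()
weighted-pick {suc n} w g pos with sumFin n (w ∘ suc) ≟ 0
... | yes rest≡0 = zero , w₀>0 , ≤-reflexive total
  where
  w₀>0 : 0 < w zero
  w₀>0 = subst (0 <_) (trans (cong (w zero +_) rest≡0) (+-identityʳ _)) pos
  vanish : ∀ j → w (suc j) * g (suc j) ≡ 0
  vanish j = cong (_* g (suc j)) (n≤0⇒n≡0 (subst (w (suc j) ≤_) rest≡0 (term≤sum (w ∘ suc) j)))
  total : w zero * g zero + sumFin n (λ j → w (suc j) * g (suc j))
        ≡ (w zero + sumFin n (w ∘ suc)) * g zero
  total rewrite trans (sum-cong vanish) (sum-zero n) | rest≡0
    | +-identityʳ (w zero) | +-identityʳ (w zero * g zero) = refl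
... | no rest≢0 with weighted-pick (w ∘ suc) (g ∘ suc) (n≢0⇒n>0 rest≢0)
...   | i , wi>0 , avg with g zero ≤? g (suc i)
...     | yes le = suc i , wi>0 , (begin
  w zero * g zero + sumFin n (λ j → w (suc j) * g (suc j))
    ≤⟨ +-mono-≤ (*-monoʳ-≤ (w zero) le) avg ⟩
  w zero * g (suc i) + sumFin n (w ∘ suc) * g (suc i)
    ≡⟨ *-distribʳ-+ (g (suc i)) (w zero) _ ⟨
  (w zero + sumFin n (w ∘ suc)) * g (suc i) ∎)
  where open ≤-Reasoning
...     | no gt with w zero ≟ 0
...       | yes w₀≡0 = suc i , wi>0 , subst
  (λ z → z * g zero + sumFin n (λ j → w (suc j) * g (suc j)) ≤ (z + sumFin n (w ∘ suc)) * g (suc i))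
  (sym w₀≡0) avg
...       | no w₀≢0 = zero , n≢0⇒n>0 w₀≢0 , (begin
  w zero * g zero + sumFin n (λ j → w (suc j) * g (suc j))
    ≤⟨ +-monoʳ-≤ (w zero * g zero) (≤-trans avg (*-monoʳ-≤ (sumFin n (w ∘ suc)) (<⇒≤ (≰⇒> gt)))) ⟩
  w zero * g zero + sumFin n (w ∘ suc) * g zero
    ≡⟨ *-distribʳ-+ (g zero) (w zero) _ ⟨
  (w zero + sumFin n (w ∘ suc)) * g zero ∎)
  where open ≤-Reasoning

sum₂ : ∀ {m n} → (Fin m → Fin n → ℕ) → ℕ
sum₂ {m} {n} F = sumFin m (λ i → sumFin n (F i))

sum₂-cong : ∀ {m n} {F G : Fin m → Fin n → ℕ} → (∀ i j → F i j ≡ G i j) → sum₂ F ≡ sum₂ G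
sum₂-cong e = sum-cong (λ i → sum-cong (e i))

sum₂-mono : ∀ {m n} {F G : Fin m → Fin n → ℕ} → (∀ i j → F i j ≤ G i j) → sum₂ F ≤ sum₂ G
sum₂-mono e = sum-mono (λ i → sum-mono (e i))

sum₂-+ : ∀ {m n} (F G : Fin m → Fin n → ℕ) → sum₂ (λ i j → F i j + G i j) ≡ sum₂ F + sum₂ G
sum₂-+ {n = n} F G = trans (sum-cong (λ i → sum-+ (F i) (G i)))
  (sum-+ (λ i → sumFin n (F i)) (λ i → sumFin n (G i)))

sum₂-*ˡ : ∀ {m n} c (F : Fin m → Fin n → ℕ) → sum₂ (λ i j → c * F i j) ≡ c * sum₂ F
sum₂-*ˡ {n = n} c F = trans (sum-cong (λ i → sum-*ˡ c (F i))) (sum-*ˡ c (λ i → sumFin n (F i)))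

χ-split : ∀ b m → m ≡ χ b * m + χ (not b) * m
χ-split true  m = sym (trans (+-identityʳ (m + 0)) (+-identityʳ m))
χ-split false m = sym (+-identityʳ m)

sum-split-by : ∀ {n} (X : Subset n) (f : Fin n → ℕ) →
  sumFin n f ≡ sumFin n (λ i → χ (X i) * f i) + sumFin n (λ i → χ (not (X i)) * f i)
sum-split-by {n} X f = trans (sum-cong (λ i → χ-split (X i) (f i))) (sum-+ {n} _ _)

χ-mono : ∀ {b c} → (b ≡ true → c ≡ true) → χ b ≤ χ c
χ-mono {false} _ = z≤n
χ-mono {true} {c} f rewrite f refl = ≤-refl

χ≤1 : ∀ b → χ b ≤ 1
χ≤1 true  = ≤-refl
χ≤1 false = z≤n

_⊆_ : ∀ {n} → Subset n → Subset n → Set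
X ⊆ Y = ∀ i → X i ≡ true → Y i ≡ true

size-mono : ∀ {n} {X Y : Subset n} → X ⊆ Y → size X ≤ size Y
size-mono X⊆Y = sum-mono (λ i → χ-mono (X⊆Y i))

does-true : ∀ {P : Set} (d : Dec P) → does d ≡ true → P
does-true (yes p) _ = p

does-false : ∀ {P : Set} (d : Dec P) → does d ≡ false → ¬ P
does-false (no ¬p) _ = ¬p

true-does : ∀ {P : Set} (d : Dec P) → P → does d ≡ true
true-does (yes _) _ = refl
true-does (no ¬p) p = contradiction p ¬p

-- The pattern of most estimates below: known inequalities are added up, `k` collects the terms
-- common to both sides, and the two equations are polynomial identities.
cancel-≤ : ∀ {u w} a b k → u ≤ w → u ≡ a + k → w ≡ b + k → a ≤ b
cancel-≤ a b k u≤w eq₁ eq₂ = +-cancelʳ-≤ k a b (subst₂ _≤_ eq₁ eq₂ u≤w)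

size≤n : ∀ {n} (X : Subset n) → size X ≤ n
size≤n {n} X = ≤-trans (sum-mono (λ i → χ≤1 (X i))) (≤-reflexive (sum-one n))

sum>0 : ∀ {n} (f : Fin n → ℕ) → 0 < sumFin n f → ∃[ i ] 0 < f i
sum>0 {suc n} f pos with f zero in eq
... | suc m = zero , subst (0 <_) (sym eq) z<s
... | zero  = let i , fi>0 = sum>0 (f ∘ suc) pos in suc i , fi>0

m*n>0 : ∀ {m n} → 0 < m → 0 < n → 0 < m * n
m*n>0 = *-mono-< {0} {_} {0}

factors>0 : ∀ m n → 0 < m * n → 0 < m × 0 < n
factors>0 (suc m) (suc n) _ = z<s , z<s
factors>0 (suc m) zero pos = contradiction (subst (0 <_) (*-zeroʳ m) pos) λ ()

sum-delta : ∀ {n} x (f : Fin n → ℕ) → sumFin n (λ z → χ (does (x Fin.≟ z)) * f z) ≡ f x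
sum-delta {suc n} zero f = trans (cong₂ _+_ (+-identityʳ (f zero)) (sum-zero n)) (+-identityʳ (f zero))
sum-delta {suc n} (suc x) f = sum-delta x (f ∘ suc)

⁅_⁆ : ∀ {n} → Fin n → Subset n
⁅ x ⁆ z = does (x Fin.≟ z)

size-⁅⁆ : ∀ {n} (x : Fin n) → size ⁅ x ⁆ ≡ 1
size-⁅⁆ {n} x = trans (sum-cong (λ z → sym (*-identityʳ (χ (⁅ x ⁆ z))))) (sum-delta x (λ _ → 1))

infixr 6 _∪_
infixr 7 _∩_

_∪_ _∩_ : ∀ {n} → Subset n → Subset n → Subset n
(X ∪ Y) z = X z ∨ Y z
(X ∩ Y) z = X z ∧ Y z

∁ : ∀ {n} → Subset n → Subset n
∁ X z = not (X z)

∨-elim : ∀ a {b} → a ∨ b ≡ true → a ≡ true ⊎ b ≡ true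
∨-elim true  _ = inj₁ refl
∨-elim false e = inj₂ e

∨-introˡ : ∀ {a} b → a ≡ true → a ∨ b ≡ true
∨-introˡ b refl = refl

∨-introʳ : ∀ a {b} → b ≡ true → a ∨ b ≡ true
∨-introʳ true  _ = refl
∨-introʳ false e = e

∧-elim : ∀ a {b} → a ∧ b ≡ true → a ≡ true × b ≡ true
∧-elim true e = refl , e

∧-intro : ∀ {a b} → a ≡ true → b ≡ true → a ∧ b ≡ true
∧-intro refl e = e

not-true : ∀ {b} → not b ≡ true → b ≡ false
not-true {false} _ = refl

size-∪ : ∀ {n} (X Y : Subset n) → size (X ∪ Y) ≤ size X + size Y
size-∪ {n} X Y = ≤-trans (sum-mono (λ z → term (X z) (Y z))) (≤-reflexive (sum-+ {n} _ _))
  where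
  term : ∀ a b → χ (a ∨ b) ≤ χ a + χ b
  term true  b = s≤s z≤n
  term false b = ≤-refl

some : ∀ {n} → Subset n → Bool
some {zero}  X = false
some {suc n} X = X zero ∨ some (X ∘ suc)

some-intro : ∀ {n} (X : Subset n) i → X i ≡ true → some X ≡ true
some-intro X zero    e = ∨-introˡ _ e
some-intro X (suc i) e = ∨-introʳ (X zero) (some-intro (X ∘ suc) i e)

some-elim : ∀ {n} (X : Subset n) → some X ≡ true → ∃[ i ] X i ≡ true
some-elim {suc n} X e with ∨-elim (X zero) e
... | inj₁ X₀ = zero , X₀
... | inj₂ rest = let i , Xi = some-elim (X ∘ suc) rest in suc i , Xi

meets : ∀ {n} → Subset n → Subset n → Bool
meets X Y = some (X ∩ Y)

-- Hitting sets by walks in an expanding network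

module Network {n : ℕ} (A : Fin n → Fin n → ℕ) (A-sym : ∀ x y → A x y ≡ A y x)
  (D : ℕ) (row : ∀ x → sumFin n (A x) ≡ D) where

  -- D times the averaging operator of the walk with transition matrix A / D.
  Q : (Fin n → ℕ) → Fin n → ℕ
  Q h x = sumFin n (λ y → A x y * h y)

  cross : Subset n → (Fin n → Fin n → ℕ) → ℕ
  cross X F = sum₂ (λ x y → χ (X x) * (χ (not (X y)) * F x y))

  inner : Subset n → (Fin n → Fin n → ℕ) → ℕ
  inner X F = sum₂ (λ x y → χ (X x) * (χ (X y) * F x y))

  inner+cross : ∀ X (F : Fin n → Fin n → ℕ) →
    sumFin n (λ x → χ (X x) * sumFin n (F x)) ≡ inner X F + cross X F
  inner+cross X F = trans (sum-cong split) (sum-+ {n} _ _)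
    where
    split : ∀ x → χ (X x) * sumFin n (F x) ≡
      sumFin n (λ y → χ (X x) * (χ (X y) * F x y)) + sumFin n (λ y → χ (X x) * (χ (not (X y)) * F x y))
    split x = trans (cong (χ (X x) *_) (sum-split-by X (F x)))
      (trans (*-distribˡ-+ (χ (X x)) _ _)
        (cong₂ _+_ (sym (sum-*ˡ (χ (X x)) (λ y → χ (X y) * F x y)))
          (sym (sum-*ˡ (χ (X x)) (λ y → χ (not (X y)) * F x y)))))

  D*≡sum : ∀ (h : Fin n → ℕ) x → D * h x ≡ sumFin n (λ y → A x y * h x)
  D*≡sum h x = trans (cong (_* h x) (sym (row x))) (sym (sum-*ʳ (h x) (A x)))

  inner-sym : ∀ X (h : Fin n → ℕ) →
    inner X (λ x y → A x y * h x) ≡ inner X (λ x y → A x y * h y)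
  inner-sym X h = trans (sum-swap {n} {n} _) (sum₂-cong flip)
    where
    comm : ∀ a b c d → a * (b * (c * d)) ≡ b * (a * (c * d))
    comm = solve-∀
    flip : ∀ x y → χ (X y) * (χ (X x) * (A y x * h y)) ≡ χ (X x) * (χ (X y) * (A x y * h y))
    flip x y = trans (comm (χ (X y)) (χ (X x)) (A y x) (h y))
      (cong (λ z → χ (X x) * (χ (X y) * (z * h y))) (A-sym y x))

  -- A discrete divergence theorem: by symmetry of `A` the flow along pairs inside X cancels, and
  -- only the pairs crossing the boundary of X remain.
  outflow : ∀ X (h : Fin n → ℕ) c κ →
    c * sumFin n (λ x → χ (X x) * (D * h x)) ≤ c * sumFin n (λ x → χ (X x) * Q h x) + κ →
    c * cross X (λ x y → A x y * h x) ≤ c * cross X (λ x y → A x y * h y) + κ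
  outflow X h c κ hyp = cancel-≤ _ _ (c * inner X (λ x y → A x y * h y)) hyp
    (trans (cong (c *_) (trans (sum-cong (λ x → cong (χ (X x) *_) (D*≡sum h x)))
      (trans (inner+cross X (λ x y → A x y * h x)) (cong (_+ cross X (λ x y → A x y * h x)) (inner-sym X h)))))
      (r₁ c (inner X (λ x y → A x y * h y)) _))
    (trans (cong (λ z → c * z + κ) (inner+cross X (λ x y → A x y * h y)))
      (r₂ c (inner X (λ x y → A x y * h y)) _ κ))
    where
    r₁ : ∀ c i o → c * (i + o) ≡ c * o + c * i
    r₁ = solve-∀
    r₂ : ∀ c i o κ → c * (i + o) + κ ≡ c * o + κ + c * i
    r₂ = solve-∀

  capacity : Subset n → ℕ
  capacity X = cross X A

  -- Level sets of a potential h that is M on N and subharmonic off N.  If little flow leaves N,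
  -- the drop of h needed to enlarge a level set by the factor 1 + 1/2L is inversely
  -- proportional to the size of that level set, so the drops form a geometric
  -- series; the constant 4 L (2 L + 1) keeps their sum below M / 2.
  module LevelSets (L r : ℕ) (W : Subset n)
    (expand : ∀ X → X ⊆ W → 2 * size X ≤ r → D * size X ≤ L * capacity X)
    (N : Subset n) (h : Fin n → ℕ) (M : ℕ) (0<D : 0 < D) (0<M : 0 < M) (0<N : 0 < size N)
    (h-supp : ∀ x → 0 < h x → W x ≡ true)
    (h-on  : ∀ x → N x ≡ true → h x ≡ M)
    (h-off : ∀ x → N x ≡ false → D * h x ≤ Q h x)
    (flow : (4 * L * (2 * L + 1)) * sumFin n (λ x → χ (N x) * (D * h x)) ≤
            (4 * L * (2 * L + 1)) * sumFin n (λ x → χ (N x) * Q h x) + size N * D * M)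
    where

    ν : ℕ
    ν = size N

    C : ℕ
    C = 4 * L * (2 * L + 1)

    -- The field `high` says that h is at least (M / 2)(1 + ν / |X|) on X. This bound is M at size
    -- ν, relaxes as X grows, and never falls below M / 2.
    record Level (X : Subset n) : Set where
      field
        contains : N ⊆ X
        upward   : ∀ {x y} → X x ≡ true → h x ≤ h y → X y ≡ true
        high     : ∀ x → X x ≡ true → M * (size X + ν) ≤ 2 * size X * h x
    open Level

    -- Off N the potential is subharmonic, so enlarging N to X cannot increase the net outflow.
    flow-from : ∀ X → N ⊆ X →
      C * cross X (λ x y → A x y * h x) ≤ C * cross X (λ x y → A x y * h y) + ν * D * M
    flow-from X N⊆X = outflow X h C (ν * D * M) (cancel-≤ _ _ (C * (sN D*h + sN Qh))
      (+-mono-≤ flow (*-monoʳ-≤ C (sum-mono off)))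
      (trans (cong (λ z → C * sN D*h + C * z) (sum-+ {n} _ _)) (r₁ C (sN D*h) (sX D*h) (sN Qh)))
      (trans (cong (λ z → C * sN Qh + ν * D * M + C * z) (sum-+ {n} _ _)) (r₂ C (sN D*h) (sX Qh) (sN Qh) _)))
      where
      D*h Qh : Fin n → ℕ
      D*h x = D * h x
      Qh = Q h
      sN sX : (Fin n → ℕ) → ℕ
      sN f = sumFin n (λ x → χ (N x) * f x)
      sX f = sumFin n (λ x → χ (X x) * f x)
      r₁ : ∀ c a b d → c * a + c * (b + d) ≡ c * b + c * (a + d)
      r₁ = solve-∀
      r₂ : ∀ c a b d κ → c * d + κ + c * (b + a) ≡ c * b + κ + c * (a + d)
      r₂ = solve-∀
      off : ∀ x → χ (X x) * D*h x + χ (N x) * Qh x ≤ χ (X x) * Qh x + χ (N x) * D*h x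
      off x with N x in eq | X x in eq′
      ... | true  | true  = ≤-reflexive (+-comm (D*h x + 0) _)
      ... | true  | false = contradiction (trans (sym (N⊆X x eq)) eq′) λ ()
      ... | false | true  = +-monoˡ-≤ 0 (+-monoˡ-≤ 0 (h-off x eq))
      ... | false | false = ≤-refl

    level-N : ∀ {X} → Level X → ν ≤ size X
    level-N l = size-mono (contains l)

    -- The threshold is the value that `high` demands of a level of size (1 + 1/(2 L)) |X|, the size
    -- that `growth` guarantees.
    next : Subset n → Subset n
    next X y = does (M * ((2 * L + 1) * size X + 2 * L * ν) ≤? (2 * L + 1) * (2 * size X) * h y)

    X⊆next : ∀ {X} → Level X → X ⊆ next X
    X⊆next {X} l x Xx = true-does (_ ≤? _) (begin
      M * ((2 * L + 1) * size X + 2 * L * ν)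
        ≤⟨ *-monoʳ-≤ M (+-monoʳ-≤ ((2 * L + 1) * size X) (*-monoˡ-≤ ν (m≤m+n (2 * L) 1))) ⟩
      M * ((2 * L + 1) * size X + (2 * L + 1) * ν) ≡⟨ r₁ M (2 * L + 1) (size X) ν ⟩
      (2 * L + 1) * (M * (size X + ν))             ≤⟨ *-monoʳ-≤ (2 * L + 1) (high l x Xx) ⟩
      (2 * L + 1) * (2 * size X * h x)             ≡⟨ *-assoc (2 * L + 1) (2 * size X) (h x) ⟨
      (2 * L + 1) * (2 * size X) * h x ∎)
      where
      open ≤-Reasoning
      r₁ : ∀ M l x v → M * (l * x + l * v) ≡ l * (M * (x + v))
      r₁ = solve-∀

    -- Every edge leaving X either ends in next X or drops by at least M ν / (2 (2L+1) |X|).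
    leak : ∀ {X} → Level X → 2 * L * sum₂ (λ x y → χ (X x) * (χ (not (next X y)) * A x y)) ≤ D * size X
    leak {X} l = *-cancelˡ-≤ (2 * (2 * L + 1) * M * ν) {{>-nonZero pos}} final
      where
      Y = next X
      K = (2 * L + 1) * (2 * size X)
      drop : ∀ x y → K * (χ (X x) * (χ (not (X y)) * (A x y * h y))) + M * ν * (χ (X x) * (χ (not (Y y)) * A x y))
        ≤ K * (χ (X x) * (χ (not (X y)) * (A x y * h x)))
      drop x y with X x in Xx
      ... | false rewrite *-zeroʳ K | *-zeroʳ (M * ν) = z≤n
      ... | true with X y in Xy | next X y in Yy
      ...   | true  | true  rewrite *-zeroʳ K | *-zeroʳ (M * ν) = z≤n
      ...   | true  | false = contradiction (trans (sym (X⊆next l y Xy)) Yy) λ ()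
      ...   | false | true  rewrite *-zeroʳ (M * ν) | +-identityʳ (K * (A x y * h y + 0 + 0)) =
              *-monoʳ-≤ K (+-monoˡ-≤ 0 (+-monoˡ-≤ 0 (*-monoʳ-≤ (A x y) hy≤hx)))
        where
        hy≤hx : h y ≤ h x
        hy≤hx with h x ≤? h y
        ... | yes le = contradiction (trans (sym (upward l Xx le)) Xy) λ ()
        ... | no gt = <⇒≤ (≰⇒> gt)
      ...   | false | false = subst₂ _≤_ (sym (r₁ K M ν (A x y) (h y))) (sym (r₂ K (A x y) (h x)))
              (*-monoʳ-≤ (A x y) (cancel-≤ (K * h y + M * ν) (K * h x) (M * ((2 * L + 1) * size X + 2 * L * ν))
                (+-mono-≤ low (*-monoʳ-≤ (2 * L + 1) (high l x Xx)))
                (r₃ K (h y) M L (size X) ν) (r₄ L (size X) (h x) M ν)))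
        where
        low : K * h y ≤ M * ((2 * L + 1) * size X + 2 * L * ν)
        low with M * ((2 * L + 1) * size X + 2 * L * ν) ≤? K * h y
        ... | no gt = <⇒≤ (≰⇒> gt)
        ... | yes le = contradiction (trans (sym (true-does (_ ≤? _) le)) Yy) λ ()
        r₁ : ∀ K M v a y → K * (1 * (1 * (a * y))) + M * v * (1 * (1 * a)) ≡ a * (K * y + M * v)
        r₁ = solve-∀
        r₂ : ∀ K a x → K * (1 * (1 * (a * x))) ≡ a * (K * x)
        r₂ = solve-∀
        r₃ : ∀ K y M L s v → K * y + (2 * L + 1) * (M * (s + v))
          ≡ K * y + M * v + M * ((2 * L + 1) * s + 2 * L * v)
        r₃ = solve-∀
        r₄ : ∀ L s x M v → M * ((2 * L + 1) * s + 2 * L * v) + (2 * L + 1) * (2 * s * x)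
          ≡ (2 * L + 1) * (2 * s) * x + M * ((2 * L + 1) * s + 2 * L * v)
        r₄ = solve-∀
      cutʸ cutˣ out : ℕ
      cutʸ = cross X (λ x y → A x y * h y)
      cutˣ = cross X (λ x y → A x y * h x)
      out = sum₂ (λ x y → χ (X x) * (χ (not (Y y)) * A x y))
      drops : K * cutʸ + M * ν * out ≤ K * cutˣ
      drops = subst₂ _≤_
        (trans (sum₂-+ {n} {n} _ _) (cong₂ _+_ (sum₂-*ˡ {n} {n} K _) (sum₂-*ˡ {n} {n} (M * ν) _)))
        (sum₂-*ˡ {n} {n} K _) (sum₂-mono drop)
      -- The drops along pairs from X to the outside of `Y` are paid for by the net flow out of X,
      -- which is at most ν D M / C.
      bound : C * (M * ν * out) ≤ K * (ν * D * M)
      bound = cancel-≤ _ _ (C * (K * cutʸ) + K * (C * cutˣ))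
        (+-mono-≤ (*-monoʳ-≤ C drops) (*-monoʳ-≤ K (flow-from X (contains l))))
        (r₁ C K cutʸ (M * ν * out) cutˣ) (r₂ C K cutʸ cutˣ (ν * D * M))
        where
        r₁ : ∀ C K y o x → C * (K * y + o) + K * (C * x) ≡ C * o + (C * (K * y) + K * (C * x))
        r₁ = solve-∀
        r₂ : ∀ C K y x z → C * (K * x) + K * (C * y + z) ≡ K * z + (C * (K * y) + K * (C * x))
        r₂ = solve-∀
      final : 2 * (2 * L + 1) * M * ν * (2 * L * out) ≤ 2 * (2 * L + 1) * M * ν * (D * size X)
      final = subst₂ _≤_ (r₁ L M ν out) (r₂ L (size X) ν D M) bound
        where
        r₁ : ∀ L M v o → 4 * L * (2 * L + 1) * (M * v * o) ≡ 2 * (2 * L + 1) * M * v * (2 * L * o)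
        r₁ = solve-∀
        r₂ : ∀ L s v D M → (2 * L + 1) * (2 * s) * (v * D * M) ≡ 2 * (2 * L + 1) * M * v * (D * s)
        r₂ = solve-∀
      pos : 0 < 2 * (2 * L + 1) * M * ν
      pos = *-mono-< {0} {_} {0} (*-mono-< {0} {_} {0} (*-mono-< {0} {2} {0} (s≤s z≤n) (m≤n+m 1 (2 * L))) 0<M) 0<N

    X⊆W : ∀ {X} → Level X → X ⊆ W
    X⊆W {X} l x Xx = h-supp x (n≢0⇒n>0 λ hx≡0 →
      contradiction (≤-trans lower (≤-trans (high l x Xx)
        (≤-reflexive (trans (cong (2 * size X *_) hx≡0) (*-zeroʳ (2 * size X)))))) λ ())
      where
      lower : 1 ≤ M * (size X + ν)
      lower = *-mono-< {0} {_} {0} 0<M (≤-trans 0<N (m≤n+m ν (size X)))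

    new : Subset n → Subset n
    new X y = next X y ∧ not (X y)

    size-next : ∀ {X} → Level X → size (next X) ≡ size X + size (new X)
    size-next {X} l = trans (sum-cong split) (sum-+ {n} _ _)
      where
      split : ∀ y → χ (next X y) ≡ χ (X y) + χ (next X y ∧ not (X y))
      split y with X y in Xy
      ... | true rewrite X⊆next l y Xy = refl
      ... | false with next X y
      ...   | true = refl
      ...   | false = refl

    -- Expansion makes weight at least D |X| / L leave X. By `leak` at most D |X| / (2 L) of it
    -- escapes `next X`; the rest ends in new vertices, each of which absorbs at most D.
    growth : ∀ {X} → Level X → 2 * size X ≤ r → size X ≤ 2 * L * size (new X)
    growth {X} l small = *-cancelˡ-≤ D {{>-nonZero 0<D}} (begin
      D * size X           ≤⟨ cancel-≤ _ _ (D * size X + 2 * L * out)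
        (+-mono-≤ (*-monoʳ-≤ 2 (≤-trans (expand X (X⊆W l) small) (*-monoʳ-≤ L capacity≤))) (leak l))
        (r₁ (D * size X) (2 * L * out)) (r₂ L into out (D * size X)) ⟩
      2 * L * into         ≤⟨ *-monoʳ-≤ (2 * L) into≤ ⟩
      2 * L * (D * size (new X)) ≡⟨ r₃ L D (size (new X)) ⟩
      D * (2 * L * size (new X)) ∎)
      where
      open ≤-Reasoning
      out into : ℕ
      out = sum₂ (λ x y → χ (X x) * (χ (not (next X y)) * A x y))
      into = sum₂ (λ x y → χ (X x) * (χ (new X y) * A x y))
      r₁ : ∀ d o → 2 * d + o ≡ d + (d + o)
      r₁ = solve-∀
      r₂ : ∀ L i o d → 2 * (L * (i + o)) + d ≡ 2 * L * i + (d + 2 * L * o)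
      r₂ = solve-∀
      r₃ : ∀ L D s → 2 * L * (D * s) ≡ D * (2 * L * s)
      r₃ = solve-∀
      capacity≤ : capacity X ≤ into + out
      capacity≤ = ≤-trans (sum₂-mono term) (≤-reflexive (sum₂-+ {n} {n} _ _))
        where
        term : ∀ x y → χ (X x) * (χ (not (X y)) * A x y) ≤
          χ (X x) * (χ (new X y) * A x y) + χ (X x) * (χ (not (next X y)) * A x y)
        term x y with X x | X y | next X y
        ... | false | _ | _ = z≤n
        ... | true | true | _ = z≤n
        ... | true | false | true = m≤m+n _ _
        ... | true | false | false = ≤-refl
      into≤ : into ≤ D * size (new X)
      into≤ = begin
        into ≡⟨ sum-swap (λ x y → χ (X x) * (χ (new X y) * A x y)) ⟩
        sum₂ (λ y x → χ (X x) * (χ (new X y) * A x y)) ≤⟨ sum₂-mono term ⟩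
        sum₂ (λ y x → χ (new X y) * A y x)
          ≡⟨ sum-cong (λ y → trans (sum-*ˡ (χ (new X y)) (A y)) (trans (cong (χ (new X y) *_) (row y)) (*-comm _ D))) ⟩
        sumFin n (λ y → D * χ (new X y)) ≡⟨ sum-*ˡ D (χ ∘ new X) ⟩
        D * size (new X) ∎
        where
        term : ∀ y x → χ (X x) * (χ (new X y) * A x y) ≤ χ (new X y) * A y x
        term y x = ≤-trans (*-monoˡ-≤ (χ (new X y) * A x y) (χ≤1 (X x)))
          (≤-reflexive (trans (*-identityˡ _) (cong (χ (new X y) *_) (A-sym x y))))

    next-level : ∀ {X} → Level X → 2 * size X ≤ r → Level (next X)
    next-level {X} l small = record
      { contains = λ x Nx → X⊆next l x (contains l x Nx)
      ; upward   = λ {x} {y} Yx hx≤hy → true-does (threshold ≤? (2 * L + 1) * (2 * size X) * h y)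
          (≤-trans (does-true (threshold ≤? (2 * L + 1) * (2 * size X) * h x) Yx) (*-monoʳ-≤ ((2 * L + 1) * (2 * size X)) hx≤hy))
      ; high     = high′
      }
      where
      open ≤-Reasoning
      threshold = M * ((2 * L + 1) * size X + 2 * L * ν)
      Y = next X
      s = size X
      s′ = size Y
      enlarged : (2 * L + 1) * s ≤ 2 * L * s′
      enlarged = begin
        (2 * L + 1) * s              ≡⟨ r₁ L s ⟩
        2 * L * s + s                ≤⟨ +-monoʳ-≤ (2 * L * s) (growth l small) ⟩
        2 * L * s + 2 * L * size (new X) ≡⟨ *-distribˡ-+ (2 * L) s _ ⟨
        2 * L * (s + size (new X))   ≡⟨ cong (2 * L *_) (size-next l) ⟨
        2 * L * s′ ∎
        where
        r₁ : ∀ L s → (2 * L + 1) * s ≡ 2 * L * s + s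
        r₁ = solve-∀
      high′ : ∀ y → Y y ≡ true → M * (s′ + ν) ≤ 2 * s′ * h y
      high′ y Yy = *-cancelˡ-≤ ((2 * L + 1) * s) {{>-nonZero (m*n>0 (m≤n+m 1 (2 * L)) (≤-trans 0<N (level-N l)))}} (begin
        (2 * L + 1) * s * (M * (s′ + ν))                     ≡⟨ r₁ ((2 * L + 1) * s) M s′ ν ⟩
        M * s′ * ((2 * L + 1) * s) + M * ν * ((2 * L + 1) * s)
          ≤⟨ +-monoʳ-≤ (M * s′ * ((2 * L + 1) * s)) (*-monoʳ-≤ (M * ν) enlarged) ⟩
        M * s′ * ((2 * L + 1) * s) + M * ν * (2 * L * s′)    ≡⟨ r₂ M s′ L s ν ⟩
        s′ * (M * ((2 * L + 1) * s + 2 * L * ν))             ≤⟨ *-monoʳ-≤ s′ (does-true (_ ≤? _) Yy) ⟩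
        s′ * ((2 * L + 1) * (2 * s) * h y)                   ≡⟨ r₃ s′ (2 * L + 1) s (h y) ⟩
        (2 * L + 1) * s * (2 * s′ * h y) ∎)
        where
        r₁ : ∀ k M t v → k * (M * (t + v)) ≡ M * t * k + M * v * k
        r₁ = solve-∀
        r₂ : ∀ M t L s v → M * t * ((2 * L + 1) * s) + M * v * (2 * L * t)
          ≡ t * (M * ((2 * L + 1) * s + 2 * L * v))
        r₂ = solve-∀
        r₃ : ∀ t l s y → t * (l * (2 * s) * y) ≡ l * s * (2 * t * y)
        r₃ = solve-∀

    -- Each round adds a vertex by `growth`, and sizes are bounded by n, so some level exceeds r / 2
    -- before the fuel is spent.
    large-level : ∀ fuel X → Level X → n < size X + fuel → ∃[ Y ] (Level Y × r < 2 * size Y)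
    large-level zero X l n< = contradiction (size≤n X) (<⇒≱ (subst (n <_) (+-identityʳ _) n<))
    large-level (suc fuel) X l n< with 2 * size X ≤? r
    ... | no big = X , l , ≰⇒> big
    ... | yes small = large-level fuel (next X) (next-level l small) (begin-strict
      n                             <⟨ n< ⟩
      size X + suc fuel             ≡⟨ +-assoc (size X) 1 fuel ⟨
      size X + 1 + fuel             ≤⟨ +-monoˡ-≤ fuel (+-monoʳ-≤ (size X) new>0) ⟩
      size X + size (new X) + fuel  ≡⟨ cong (_+ fuel) (size-next l) ⟨
      size (next X) + fuel ∎)
      where
      open ≤-Reasoning
      new>0 : 0 < size (new X)
      new>0 = proj₂ (factors>0 (2 * L) _ (≤-trans (≤-trans 0<N (level-N l)) (growth l small)))

    top : Subset n
    top x = does (M ≤? h x)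

    top-level : Level top
    top-level = record
      { contains = N⊆top
      ; upward   = λ {x} {y} Xx hx≤hy → true-does (M ≤? h y) (≤-trans (does-true (M ≤? h x) Xx) hx≤hy)
      ; high     = λ x Xx → begin
          M * (size top + ν)        ≤⟨ *-monoʳ-≤ M (+-monoʳ-≤ (size top) (size-mono N⊆top)) ⟩
          M * (size top + size top) ≡⟨ r₁ M (size top) ⟩
          2 * size top * M          ≤⟨ *-monoʳ-≤ (2 * size top) (does-true (_ ≤? _) Xx) ⟩
          2 * size top * h x ∎
      }
      where
      open ≤-Reasoning
      N⊆top : N ⊆ top
      N⊆top x Nx = true-does (_ ≤? _) (≤-reflexive (sym (h-on x Nx)))
      r₁ : ∀ M s → M * (s + s) ≡ 2 * s * M
      r₁ = solve-∀

    -- The last level has more than r / 2 vertices, and `high` gives h at least M / 2 on each of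
    -- them.
    potential-large : r * M ≤ 4 * sumFin n h
    potential-large with large-level (suc n) top top-level (m≤n+m (suc n) _)
    ... | X , l , big = begin
      r * M                                ≤⟨ *-monoˡ-≤ M (<⇒≤ big) ⟩
      2 * size X * M                       ≡⟨ *-assoc 2 (size X) M ⟩
      2 * (size X * M)                     ≡⟨ cong (2 *_) (sum-*ʳ M (χ ∘ X)) ⟨
      2 * sumFin n (λ x → χ (X x) * M)     ≤⟨ *-monoʳ-≤ 2 (sum-mono half) ⟩
      2 * sumFin n (λ x → 2 * h x)         ≡⟨ cong (2 *_) (sum-*ˡ 2 h) ⟩
      2 * (2 * sumFin n h)                 ≡⟨ *-assoc 2 2 (sumFin n h) ⟨
      4 * sumFin n h ∎
      where
      open ≤-Reasoning
      r₁ : ∀ s y → 2 * s * y ≡ s * (2 * y)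
      r₁ = solve-∀
      half : ∀ x → χ (X x) * M ≤ 2 * h x
      half x with X x in Xx
      ... | false = z≤n
      ... | true = *-cancelˡ-≤ (size X) {{>-nonZero (≤-trans 0<N (level-N l))}} (begin
        size X * (M + 0)   ≡⟨ cong (size X *_) (+-identityʳ M) ⟩
        size X * M         ≡⟨ *-comm (size X) M ⟩
        M * size X         ≤⟨ *-monoʳ-≤ M (m≤m+n _ ν) ⟩
        M * (size X + ν)   ≤⟨ high l x Xx ⟩
        2 * size X * h x   ≡⟨ r₁ (size X) (h x) ⟩
        size X * (2 * h x) ∎)

  -- H N t x counts the weighted walks of t steps from x that meet N.
  H : Subset n → ℕ → Fin n → ℕ
  H N zero    x = χ (N x)
  H N (suc t) x = if N x then D ^ suc t else Q (H N t) x

  module Hitting (L r : ℕ) (W : Subset n) (0<D : 0 < D) (0<L : 0 < L)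
    (expand : ∀ X → X ⊆ W → 2 * size X ≤ r → D * size X ≤ L * capacity X)
    (inside : ∀ x y → 0 < A x y → x ≡ y ⊎ (W x ≡ true × W y ≡ true))
    (N : Subset n) (N⊆W : N ⊆ W)
    where

    H-on : ∀ t x → N x ≡ true → H N t x ≡ D ^ t
    H-on zero    x Nx rewrite Nx = refl
    H-on (suc t) x Nx rewrite Nx = refl

    H-off : ∀ t x → N x ≡ false → H N (suc t) x ≡ Q (H N t) x
    H-off t x ¬Nx rewrite ¬Nx = refl

    -- A walk that has met N keeps this property under all its extensions, of total weight D. This
    -- makes `H N t` subharmonic off N.
    H-mono : ∀ t x → D * H N t x ≤ H N (suc t) x
    H-mono t x with N x in eq
    ... | true = ≤-reflexive (cong (D *_) (H-on t x eq))
    H-mono zero x | false rewrite eq | *-zeroʳ D = z≤n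
    H-mono (suc t) x | false rewrite eq = begin
      D * sumFin n (λ y → A x y * H N t y)     ≡⟨ sum-*ˡ D (λ y → A x y * H N t y) ⟨
      sumFin n (λ y → D * (A x y * H N t y))
        ≤⟨ sum-mono (λ y → ≤-trans (≤-reflexive (r₁ D (A x y) (H N t y))) (*-monoʳ-≤ (A x y) (H-mono t y))) ⟩
      sumFin n (λ y → A x y * H N (suc t) y) ∎
      where
      open ≤-Reasoning
      r₁ : ∀ d a y → d * (a * y) ≡ a * (d * y)
      r₁ = solve-∀

    H-supp : ∀ t x → 0 < H N t x → W x ≡ true
    H-supp t x pos with N x in eq
    ... | true = N⊆W x eq
    H-supp zero x pos | false = contradiction (subst (λ b → 0 < χ b) eq pos) λ ()
    H-supp (suc t) x pos | false with sum>0 _ (subst (0 <_) (H-off t x eq) pos)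
    ... | y , pos′ with factors>0 (A x y) _ pos′
    ...   | Axy>0 , Hy>0 with inside x y Axy>0
    ...     | inj₁ refl     = H-supp t x Hy>0
    ...     | inj₂ (Wx , _) = Wx

    Q-total : ∀ (h : Fin n → ℕ) → sumFin n (Q h) ≡ D * sumFin n h
    Q-total h = trans (sum-swap (λ x y → A x y * h y)) (trans (sum-cong column) (sum-*ˡ D h))
      where
      column : ∀ y → sumFin n (λ x → A x y * h y) ≡ D * h y
      column y = trans (sum-cong (λ x → cong (_* h y) (A-sym x y))) (sym (D*≡sum h y))

    -- Mass balance: Q multiplies the total by D, and replacing Q by D on N adds exactly the net
    -- outflow from N.
    H-total : ∀ t → sumFin n (H N (suc t)) + sumFin n (λ x → χ (N x) * Q (H N t) x)
      ≡ D * sumFin n (H N t) + sumFin n (λ x → χ (N x) * (D * H N t x))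
    H-total t = trans (sym (sum-+ {n} _ _)) (trans (sum-cong term)
      (trans (sum-+ {n} _ _) (cong (_+ sumFin n (λ x → χ (N x) * (D * H N t x))) (Q-total (H N t)))))
      where
      term : ∀ x → H N (suc t) x + χ (N x) * Q (H N t) x ≡ Q (H N t) x + χ (N x) * (D * H N t x)
      term x with N x in eq
      ... | true  = trans (cong₂ _+_ (cong (D *_) (sym (H-on t x eq))) (+-identityʳ _))
                      (trans (+-comm (D * H N t x) _) (cong (Q (H N t) x +_) (sym (+-identityʳ _))))
      ... | false = refl

    -- Large outflow from N adds |N| D^(t+1) / C to the total by `H-total`, which pays for one more
    -- step. For small outflow `potential-large` bounds the total at time t below by r D^t / 4, and
    -- since the walk is short this suffices without the induction hypothesis.
    hitting : ∀ t → 4 * (suc t * size N) ≤ 4 * L * (2 * L + 1) * r →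
      suc t * size N * D ^ t ≤ 4 * L * (2 * L + 1) * sumFin n (H N t)
    hitting zero _ = ≤-trans (≤-reflexive (r₁ (size N))) (≤-trans (≤-reflexive (sym (*-identityˡ _)))
      (*-monoˡ-≤ (size N) (m*n>0 (m*n>0 {4} z<s 0<L) (m≤n+m 1 (2 * L)))))
      where
      r₁ : ∀ v → (1 * v) * 1 ≡ v
      r₁ = solve-∀
    hitting (suc t) short with size N ≟ 0
    ... | yes ν≡0 = subst (_≤ 4 * L * (2 * L + 1) * sumFin n (H N (suc t))) (sym (trans (cong (λ v → suc (suc t) * v * D ^ suc t) ν≡0)
                      (cong (_* D ^ suc t) (*-zeroʳ (suc (suc t)))))) z≤n
    ... | no ν≢0 with c * sumFin n (λ x → χ (N x) * (D * H N t x)) ≤?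
                      c * sumFin n (λ x → χ (N x) * Q (H N t) x) + size N * D * D ^ t
      where c = 4 * L * (2 * L + 1)
    ...   | yes little = *-cancelˡ-≤ 4 (begin
      4 * (suc (suc t) * size N * D ^ suc t)    ≡⟨ *-assoc 4 (suc (suc t) * size N) (D ^ suc t) ⟨
      4 * (suc (suc t) * size N) * D ^ suc t    ≤⟨ *-monoˡ-≤ (D ^ suc t) short ⟩
      c * r * (D * D ^ t)                       ≡⟨ r₁ c r D (D ^ t) ⟩
      c * D * (r * D ^ t)                       ≤⟨ *-monoʳ-≤ (c * D) potential-large ⟩
      c * D * (4 * sumFin n (H N t))              ≡⟨ r₂ c D (sumFin n (H N t)) ⟩
      4 * (c * (D * sumFin n (H N t)))            ≡⟨ cong (λ z → 4 * (c * z)) (sum-*ˡ D (H N t)) ⟨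
      4 * (c * sumFin n (λ x → D * H N t x))      ≤⟨ *-monoʳ-≤ 4 (*-monoʳ-≤ c (sum-mono (H-mono t))) ⟩
      4 * (c * sumFin n (H N (suc t))) ∎)
      where
      open ≤-Reasoning
      c = 4 * L * (2 * L + 1)
      open LevelSets L r W expand N (H N t) (D ^ t) 0<D (m^n>0 D {{>-nonZero 0<D}} t) (n≢0⇒n>0 ν≢0)
        (H-supp t) (H-on t) (λ x ¬Nx → ≤-trans (H-mono t x) (≤-reflexive (H-off t x ¬Nx))) little
        using (potential-large)
      r₁ : ∀ c r d m → c * r * (d * m) ≡ c * d * (r * m)
      r₁ = solve-∀
      r₂ : ∀ c d z → c * d * (4 * z) ≡ 4 * (c * (d * z))
      r₂ = solve-∀
    ...   | no much = cancel-≤ _ _ (c * b + c * a + c * (D * T))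
      (+-mono-≤ (+-mono-≤ (*-monoʳ-≤ D (hitting t (≤-trans (*-monoʳ-≤ 4 (*-monoˡ-≤ (size N) (n≤1+n (suc t)))) short)))
        (<⇒≤ (≰⇒> much))) (≤-reflexive (cong (c *_) (sym (H-total t)))))
      (r₁ D (suc t) (size N) (D ^ t) (c * b) c T a) (r₂ D c T a T′ b)
      where
      c = 4 * L * (2 * L + 1)
      a = sumFin n (λ x → χ (N x) * (D * H N t x))
      b = sumFin n (λ x → χ (N x) * Q (H N t) x)
      T = sumFin n (H N t)
      T′ = sumFin n (H N (suc t))
      r₁ : ∀ D t v m cb c T a → D * (t * v * m) + (cb + v * D * m) + c * (D * T + a)
        ≡ (1 + t) * v * (D * m) + (cb + c * a + c * (D * T))
      r₁ = solve-∀
      r₂ : ∀ D c T a T′ b → D * (c * T) + c * a + c * (T′ + b) ≡ c * T′ + (c * b + c * a + c * (D * T))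
      r₂ = solve-∀

-- Connected sets traced by walks

module Trails {n : ℕ} (G : Graph n) where

  Reaches : Subset n → Fin n → Set
  Reaches T x = ∀ z → T z ≡ true → WalkIn G T x z

  widen : ∀ {S T x y} → S ⊆ T → WalkIn G S x y → WalkIn G T x y
  widen S⊆T (here Sx) = here (S⊆T _ Sx)
  widen S⊆T (step Sx e w) = step (S⊆T _ Sx) e (widen S⊆T w)

  starts : ∀ {T x y} → WalkIn G T x y → T x ≡ true
  starts (here Tx) = Tx
  starts (step Tx _ _) = Tx

  append : ∀ {T x y z} → WalkIn G T x y → WalkIn G T y z → WalkIn G T x z
  append (here _) w = w
  append (step Tx e v) w = step Tx e (append v w)

  reverse : ∀ {T x y} → WalkIn G T x y → WalkIn G T y x
  reverse (here Tx) = here Tx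
  reverse (step {x} {y} Tx e w) =
    append (reverse w) (step (starts w) (trans (adj-sym G y x) e) (here Tx))

  reaches⇒connected : ∀ {T x} → T x ≡ true → Reaches T x → ConnectedIn G T
  reaches⇒connected {x = x} Tx reach =
    (x , Tx) , λ u v Tu Tv → append (reverse (reach u Tu)) (reach v Tv)

  module _ (A : Fin n → Fin n → ℕ) (A-sym : ∀ x y → A x y ≡ A y x)
    (D : ℕ) (row : ∀ x → sumFin n (A x) ≡ D) (W : Subset n) (0<D : 0 < D)
    (along : ∀ x y → 0 < A x y → x ≡ y ⊎ (W x ≡ true × W y ≡ true × adj G x y ≡ true))
    {k : ℕ} (N : Fin k → Subset n)
    where
    open Network A A-sym D row

    hit : (Fin k → Bool) → Subset n → ℕ
    hit alive T = sumFin k (λ j → χ (alive j ∧ meets T (N j)))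

    -- Derandomised random walk: each step goes to a neighbour for which the expected number
    -- of sets N j met later is at least the average.
    trail : ∀ t x → W x ≡ true → (alive : Fin k → Bool) → ∃[ T ]
      (T x ≡ true × T ⊆ W × size T ≤ suc t × Reaches T x ×
       sumFin k (λ j → χ (alive j) * H (N j) t x) ≤ D ^ t * hit alive T)
    trail zero x Wx alive = ⁅ x ⁆ , xx , sub , ≤-reflexive (size-⁅⁆ x) , reach ,
      ≤-trans (sum-mono term) (≤-reflexive (sym (*-identityˡ _)))
      where
      xx : ⁅ x ⁆ x ≡ true
      xx = true-does (x Fin.≟ x) refl
      sub : ⁅ x ⁆ ⊆ W
      sub z e = subst (λ v → W v ≡ true) (does-true (x Fin.≟ z) e) Wx
      reach : Reaches ⁅ x ⁆ x
      reach z e with does-true (x Fin.≟ z) e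
      ... | refl = here e
      term : ∀ j → χ (alive j) * χ (N j x) ≤ χ (alive j ∧ meets ⁅ x ⁆ (N j))
      term j with alive j | N j x in Nx
      ... | false | _     = z≤n
      ... | true  | false = z≤n
      ... | true  | true rewrite some-intro (⁅ x ⁆ ∩ N j) x (∧-intro xx Nx) = ≤-refl
    trail (suc t) x Wx alive = build (weighted-pick (A x) later (subst (0 <_) (sym (row x)) 0<D))
      where
      open ≤-Reasoning
      -- Sets containing x are credited now and then dropped, so that each set is counted once even
      -- if the trail meets it again.
      alive′ : Fin k → Bool
      alive′ j = alive j ∧ not (N j x)
      later : Fin n → ℕ
      later y = sumFin k (λ j → χ (alive′ j) * H (N j) t y)
      now : ℕ
      now = sumFin k (λ j → χ (alive j ∧ N j x))
      split : ∀ j → χ (alive j) * H (N j) (suc t) x ≡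
        D ^ suc t * χ (alive j ∧ N j x) + χ (alive′ j) * Q (H (N j) t) x
      split j with alive j | N j x
      ... | false | _     = sym (trans (+-identityʳ _) (*-zeroʳ (D ^ suc t)))
      ... | true  | true  = sym (trans (+-identityʳ _) (*-comm (D ^ suc t) 1))
      ... | true  | false = sym (cong (_+ (Q (H (N j) t) x + 0)) (*-zeroʳ (D ^ suc t)))
      exchange : sumFin k (λ j → χ (alive′ j) * Q (H (N j) t) x) ≡ sumFin n (λ y → A x y * later y)
      exchange = trans (sum-cong (λ j → sym (sum-*ˡ (χ (alive′ j)) (λ y → A x y * H (N j) t y))))
        (trans (sum-swap (λ j y → χ (alive′ j) * (A x y * H (N j) t y)))
          (sum-cong (λ y → trans (sum-cong (λ j → r₁ (χ (alive′ j)) (A x y) (H (N j) t y)))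
            (sum-*ˡ (A x y) (λ j → χ (alive′ j) * H (N j) t y)))))
        where
        r₁ : ∀ a b c → a * (b * c) ≡ b * (a * c)
        r₁ = solve-∀
      build : ∃[ y ] (0 < A x y × sumFin n (λ z → A x z * later z) ≤ sumFin n (A x) * later y) → ∃[ T ]
        (T x ≡ true × T ⊆ W × size T ≤ suc (suc t) × Reaches T x ×
         sumFin k (λ j → χ (alive j) * H (N j) (suc t) x) ≤ D ^ suc t * hit alive T)
      build (y , Axy>0 , avg) = extend (trail t y Wy alive′)
        where
        Wy : W y ≡ true
        Wy with along x y Axy>0
        ... | inj₁ x≡y          = subst (λ v → W v ≡ true) x≡y Wx
        ... | inj₂ (_ , Wy , _) = Wy
        extend : _ → _
        extend (S , Sy , S⊆W , S≤ , reach , hits) =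
          T , Tx , T⊆W , ≤-trans (size-∪ ⁅ x ⁆ S) (+-mono-≤ (≤-reflexive (size-⁅⁆ x)) S≤) , reach′ ,
          (begin
            sumFin k (λ j → χ (alive j) * H (N j) (suc t) x)
              ≡⟨ trans (sum-cong split) (sum-+ {k} _ _) ⟩
            sumFin k (λ j → D ^ suc t * χ (alive j ∧ N j x)) + sumFin k (λ j → χ (alive′ j) * Q (H (N j) t) x)
              ≡⟨ cong₂ _+_ (sum-*ˡ (D ^ suc t) (λ j → χ (alive j ∧ N j x))) exchange ⟩
            D ^ suc t * now + sumFin n (λ y → A x y * later y)
              ≤⟨ +-monoʳ-≤ (D ^ suc t * now) (≤-trans avg (≤-reflexive (cong (_* later y) (row x)))) ⟩
            D ^ suc t * now + D * later y
              ≤⟨ +-monoʳ-≤ (D ^ suc t * now) (*-monoʳ-≤ D hits) ⟩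
            D ^ suc t * now + D * (D ^ t * hit alive′ S)
              ≡⟨ cong (D ^ suc t * now +_) (*-assoc D (D ^ t) (hit alive′ S)) ⟨
            D ^ suc t * now + D ^ suc t * hit alive′ S
              ≡⟨ *-distribˡ-+ (D ^ suc t) now (hit alive′ S) ⟨
            D ^ suc t * (now + hit alive′ S)
              ≤⟨ *-monoʳ-≤ (D ^ suc t) (≤-trans (≤-reflexive (sym (sum-+ {k} _ _))) (sum-mono term)) ⟩
            D ^ suc t * hit alive T ∎)
          where
          T = ⁅ x ⁆ ∪ S
          Tx : T x ≡ true
          Tx = ∨-introˡ _ (true-does (x Fin.≟ x) refl)
          S⊆T : S ⊆ T
          S⊆T z = ∨-introʳ (⁅ x ⁆ z)
          T⊆W : T ⊆ W
          T⊆W z Tz with ∨-elim (⁅ x ⁆ z) Tz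
          ... | inj₁ e  = subst (λ v → W v ≡ true) (does-true (x Fin.≟ z) e) Wx
          ... | inj₂ Sz = S⊆W z Sz
          reach′ : Reaches T x
          reach′ z Tz with ∨-elim (⁅ x ⁆ z) Tz
          ... | inj₁ e with does-true (x Fin.≟ z) e
          ...   | refl = here Tx
          reach′ z Tz | inj₂ Sz with along x y Axy>0
          ...   | inj₁ refl = widen S⊆T (reach z Sz)
          ...   | inj₂ (_ , _ , xy) = step Tx xy (widen S⊆T (reach z Sz))
          term : ∀ j → χ (alive j ∧ N j x) + χ (alive′ j ∧ meets S (N j)) ≤ χ (alive j ∧ meets T (N j))
          term j with alive j | N j x in Nx
          ... | false | _     = z≤n
          ... | true  | true rewrite some-intro (T ∩ N j) x (∧-intro Tx Nx) = ≤-refl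
          ... | true  | false = χ-mono (λ e → let z , SN = some-elim (S ∩ N j) e
                                                  Sz , Nz = ∧-elim (S z) SN
                                              in some-intro (T ∩ N j) z (∧-intro (S⊆T z Sz) Nz))

    module _ (L r : ℕ) (0<L : 0 < L) (0<W : 0 < size W)
      (expand : ∀ X → X ⊆ W → 2 * size X ≤ r → D * size X ≤ L * capacity X)
      (N⊆W : ∀ j → N j ⊆ W)
      where

      -- For a uniform start in W the expected number of sets met is the sum of their hitting
      -- probabilities, bounded by `hitting`; `weighted-pick` and `trail` realise this expectation.
      -- Starts outside W contribute nothing because H vanishes there.
      block : ∀ t → (∀ j → 4 * (suc t * size (N j)) ≤ 4 * L * (2 * L + 1) * r) → ∃[ T ]
        (ConnectedIn G T × T ⊆ W × size T ≤ suc t ×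
         suc t * sumFin k (size ∘ N) ≤ 4 * L * (2 * L + 1) * size W * sumFin k (λ j → χ (meets T (N j))))
      block t short with weighted-pick (χ ∘ W) (λ x → sumFin k (λ j → 1 * H (N j) t x)) 0<W
      ... | x , Wx>0 , avg with trail t x (χ>0 Wx>0) (λ _ → true)
        where
        χ>0 : ∀ {b} → 0 < χ b → b ≡ true
        χ>0 {true} _ = refl
      ...   | T , Tx , T⊆W , T≤ , reach , hits = T , reaches⇒connected Tx reach , T⊆W , T≤ ,
        *-cancelˡ-≤ (D ^ t) {{>-nonZero (m^n>0 D {{>-nonZero 0<D}} t)}} (begin
          D ^ t * (suc t * sumFin k (size ∘ N))
            ≡⟨ trans (r₁ (D ^ t) (suc t) (sumFin k (size ∘ N))) (sym (sum-*ʳ (suc t * D ^ t) (size ∘ N))) ⟩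
          sumFin k (λ j → size (N j) * (suc t * D ^ t))
            ≤⟨ sum-mono each ⟩
          sumFin k (λ j → c * sumFin n (H (N j) t))
            ≡⟨ sum-*ˡ c (λ j → sumFin n (H (N j) t)) ⟩
          c * sum₂ (λ j → H (N j) t)
            ≡⟨ cong (c *_) (trans (sum-swap (λ j → H (N j) t)) (sum-cong restrict)) ⟩
          c * sumFin n (λ y → χ (W y) * sumFin k (λ j → 1 * H (N j) t y))
            ≤⟨ *-monoʳ-≤ c (≤-trans avg (*-monoʳ-≤ (size W) hits)) ⟩
          c * (size W * (D ^ t * hit (λ _ → true) T))
            ≡⟨ r₂ c (size W) (D ^ t) (hit (λ _ → true) T) ⟩
          D ^ t * (c * size W * hit (λ _ → true) T) ∎)
        where
        open ≤-Reasoning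
        c = 4 * L * (2 * L + 1)
        inside : ∀ x y → 0 < A x y → x ≡ y ⊎ (W x ≡ true × W y ≡ true)
        inside x y pos with along x y pos
        ... | inj₁ e = inj₁ e
        ... | inj₂ (Wx , Wy , _) = inj₂ (Wx , Wy)
        r₁ : ∀ d s v → d * (s * v) ≡ v * (s * d)
        r₁ = solve-∀
        r₂ : ∀ c w d h → c * (w * (d * h)) ≡ d * (c * w * h)
        r₂ = solve-∀
        r₃ : ∀ v s d → v * (s * d) ≡ s * v * d
        r₃ = solve-∀
        each : ∀ j → size (N j) * (suc t * D ^ t) ≤ c * sumFin n (H (N j) t)
        each j = ≤-trans (≤-reflexive (r₃ (size (N j)) (suc t) (D ^ t)))
          (Hitting.hitting L r W 0<D 0<L expand inside (N j) (N⊆W j) t (short j))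
        restrict : ∀ y → sumFin k (λ j → H (N j) t y) ≡ χ (W y) * sumFin k (λ j → 1 * H (N j) t y)
        restrict y with W y in Wy
        ... | true  = trans (sum-cong {k} (λ j → sym (*-identityˡ (H (N j) t y)))) (sym (*-identityˡ _))
        ... | false = trans (sum-cong zeros) (sum-zero k)
          where
          zeros : ∀ j → H (N j) t y ≡ 0
          zeros j with H (N j) t y in eq
          ... | zero  = refl
          ... | suc _ = contradiction (trans (sym Wy)
            (Hitting.H-supp L r W 0<D 0<L expand inside (N j) (N⊆W j) t y (subst (0 <_) (sym eq) z<s))) λ ()

-- Jumbled graphs

cons : ∀ {n} → Bool → Subset n → Subset (suc n)
cons b X zero    = b
cons b X (suc i) = X i

-- The constructive case distinction between having a sparse cut and having none, by trying all
-- subsets. The second hypothesis stands in for function extensionality.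
search : ∀ {n} (P : Subset n → Set) → (∀ {X Y} → (∀ i → X i ≡ Y i) → P X → P Y) →
  (∀ X → Dec (P X)) → (∃[ X ] P X) ⊎ (∀ X → ¬ P X)
search {zero} P resp P? with P? (λ ())
... | yes p = inj₁ (_ , p)
... | no ¬p = inj₂ (λ X PX → ¬p (resp (λ ()) PX))
search {suc n} P resp P? with half true | half false
  where
  half : ∀ b → (∃[ X ] P (cons b X)) ⊎ (∀ X → ¬ P (cons b X))
  half b = search (P ∘ cons b) (λ e → resp λ { zero → refl ; (suc i) → e i }) (P? ∘ cons b)
... | inj₁ (X , p) | _ = inj₁ (_ , p)
... | inj₂ _ | inj₁ (X , p) = inj₁ (_ , p)
... | inj₂ ¬t | inj₂ ¬f = inj₂ none
  where
  none : ∀ X → ¬ P X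
  none X p with X zero in eq
  ... | true  = ¬t (X ∘ suc) (resp (λ { zero → eq ; (suc i) → refl }) p)
  ... | false = ¬f (X ∘ suc) (resp (λ { zero → eq ; (suc i) → refl }) p)

-- A disjoint union, stated through indicator functions so that sizes and edge counts split by
-- linearity.
record Splits {n : ℕ} (X Y Z : Subset n) : Set where
  constructor splits
  field
    pointwise : ∀ i → χ (X i) ≡ χ (Y i) + χ (Z i)
open Splits

size-split : ∀ {n} {X Y Z : Subset n} → Splits X Y Z → size X ≡ size Y + size Z
size-split {n} s = trans (sum-cong (pointwise s)) (sum-+ {n} _ _)

full : ∀ {n} → Subset n
full _ = true

split-full : ∀ {n} (X : Subset n) → Splits full X (∁ X)
split-full X = splits λ i → cases (X i)
  where
  cases : ∀ b → 1 ≡ χ b + χ (not b)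
  cases true  = refl
  cases false = refl

split-⊆ : ∀ {n} {Z R : Subset n} → Z ⊆ R → Splits R Z (R ∩ ∁ Z)
split-⊆ {Z = Z} {R} Z⊆R = splits λ i → cases (Z i) (R i) (Z⊆R i)
  where
  cases : ∀ z r → (z ≡ true → r ≡ true) → χ r ≡ χ z + χ (r ∧ not z)
  cases true  r z⇒r rewrite z⇒r refl = refl
  cases false true  _ = refl
  cases false false _ = refl

size-full : ∀ n → size (full {n}) ≡ n
size-full = sum-one

module Edges {n : ℕ} (G : Graph n) where

  e : Subset n → Subset n → ℕ
  e X Y = sum₂ (λ x y → χ (X x) * (χ (Y y) * χ (adj G x y)))

  deg : Fin n → ℕ
  deg x = sumFin n (λ y → χ (adj G x y))

  e-cong : ∀ {X X′ Y Y′} → (∀ i → X i ≡ X′ i) → (∀ i → Y i ≡ Y′ i) → e X Y ≡ e X′ Y′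
  e-cong p q = sum₂-cong (λ x y → cong₂ (λ u v → χ u * (χ v * χ (adj G x y))) (p x) (q y))

  e-mono : ∀ {X X′ Y Y′} → X ⊆ X′ → Y ⊆ Y′ → e X Y ≤ e X′ Y′
  e-mono p q = sum₂-mono (λ x y → *-mono-≤ (χ-mono (p x)) (*-monoˡ-≤ (χ (adj G x y)) (χ-mono (q y))))

  e-sym : ∀ X Y → e X Y ≡ e Y X
  e-sym X Y = trans (sum-swap {n} {n} _) (sum₂-cong (λ y x →
    trans (r₁ (χ (X x)) (χ (Y y)) _) (cong (λ c → χ (Y y) * (χ (X x) * χ c)) (adj-sym G x y))))
    where
    r₁ : ∀ a b c → a * (b * c) ≡ b * (a * c)
    r₁ = solve-∀

  e-splitˡ : ∀ {X X₁ X₂} Y → Splits X X₁ X₂ → e X Y ≡ e X₁ Y + e X₂ Y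
  e-splitˡ {X} {X₁} {X₂} Y s = trans (sum₂-cong (λ x y →
    trans (cong (_* (χ (Y y) * χ (adj G x y))) (pointwise s x)) (*-distribʳ-+ (χ (Y y) * χ (adj G x y)) (χ (X₁ x)) (χ (X₂ x)))))
    (sum₂-+ {n} {n} _ _)

  e-splitʳ : ∀ {X X₁ X₂} Y → Splits X X₁ X₂ → e Y X ≡ e Y X₁ + e Y X₂
  e-splitʳ {X} {X₁} {X₂} Y s = trans (e-sym Y X)
    (trans (e-splitˡ Y s) (cong₂ _+_ (e-sym X₁ Y) (e-sym X₂ Y)))

  e-square : ∀ {X X₁ X₂} → Splits X X₁ X₂ → e X X ≡ e X₁ X₁ + 2 * e X₁ X₂ + e X₂ X₂
  e-square {X} {X₁} {X₂} s = trans (e-splitˡ X s)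
    (trans (cong₂ _+_ (e-splitʳ X₁ s) (trans (e-splitʳ X₂ s) (cong (_+ e X₂ X₂) (e-sym X₂ X₁))))
      (r₁ (e X₁ X₁) (e X₁ X₂) (e X₂ X₂)))
    where
    r₁ : ∀ p q r → p + q + (q + r) ≡ p + 2 * q + r
    r₁ = solve-∀

  e-full : ∀ X → e X full ≡ sumFin n (λ x → χ (X x) * deg x)
  e-full X = sum-cong (λ x → trans (sum-*ˡ (χ (X x)) (λ y → 1 * χ (adj G x y)))
    (cong (χ (X x) *_) (sum-cong {n} (λ y → *-identityˡ (χ (adj G x y))))))

  2*eIn≡e : ∀ X → 2 * eIn G X ≡ e X X
  2*eIn≡e X = trans (cong (eIn G X +_) (trans (+-identityʳ _) (sum-swap below)))
    (trans (sym (sum₂-+ below (λ i j → below j i))) (sum₂-cong term))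
    where
    below : Fin n → Fin n → ℕ
    below i j = χ (X i ∧ X j ∧ adj G i j ∧ (toℕ i <ᵇ toℕ j))
    order : ∀ i j → adj G i j ≡ true → χ (toℕ i <ᵇ toℕ j) + χ (toℕ j <ᵇ toℕ i) ≡ 1
    order i j ij with toℕ i <ᵇ toℕ j in lt | toℕ j <ᵇ toℕ i in gt
    ... | true  | false = refl
    ... | false | true  = refl
    ... | true  | true  = contradiction (<ᵇ⇒< (toℕ j) (toℕ i) (subst Bool.T (sym gt) tt))
                            (<-asym (<ᵇ⇒< (toℕ i) (toℕ j) (subst Bool.T (sym lt) tt)))
    ... | false | false = contradiction (trans (sym ij) (subst (λ k → adj G i k ≡ false) i≡j (adj-irrefl G i))) λ ()
      where
      i≡j : i ≡ j
      i≡j = toℕ-injective (≤-antisym (≮⇒≥ (λ p → subst Bool.T gt (<⇒<ᵇ p))) (≮⇒≥ (λ p → subst Bool.T lt (<⇒<ᵇ p))))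
    term : ∀ i j → below i j + below j i ≡ χ (X i) * (χ (X j) * χ (adj G i j))
    term i j rewrite adj-sym G j i with X i | X j | adj G i j in ij
    ... | false | false | _     = refl
    ... | false | true  | _     = refl
    ... | true  | false | _     = refl
    ... | true  | true  | false = refl
    ... | true  | true  | true  = order i j ij

-- The hypotheses say that |b e(X,X) − a |X|²| ≤ a n |X| / E, with e counting ordered pairs.
module Pseudorandom {n : ℕ} (G : Graph n) (a b E : ℕ) (0<a : 0 < a) (0<b : 0 < b) (0<n : 0 < n) (50≤E : 50 ≤ E)
  (upper : ∀ X → E * b * Edges.e G X X ≤ E * a * (size X * size X) + a * n * size X)
  (lower : ∀ X → E * a * (size X * size X) ≤ E * b * Edges.e G X X + a * n * size X)
  where
  open Edges G

  -- Twice the typical degree p n, scaled by b; it bounds the scaled degrees of light vertices and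
  -- becomes the row sum of the lazy walk.
  D : ℕ
  D = 2 * a * n

  0<D : 0 < D
  0<D = m*n>0 (m*n>0 {2} z<s 0<a) 0<n

  0<E : 0 < E
  0<E = ≤-trans (s≤s z≤n) 50≤E

  2≤E : 2 ≤ E
  2≤E = ≤-trans (s≤s (s≤s z≤n)) 50≤E

  -- Polarisation: 2 e(Z,W) = e(X,X) - e(Z,Z) - e(W,W), and the three error terms add up to 2 a n
  -- (|Z| + |W|).
  cut-lower : ∀ {X Z W} → Splits X Z W →
    E * a * (size Z * size W) ≤ E * b * e Z W + a * n * (size Z + size W)
  cut-lower {X} {Z} {W} s = *-cancelˡ-≤ 2 (cancel-≤ _ _ (E * a * (z * z + w * w) + E * b * (e Z Z + e W W))
    (+-mono-≤ (subst₂ (λ k l → E * a * (k * k) ≤ E * b * l + a * n * k) (size-split s) (e-square s) (lower X))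
      (+-mono-≤ (upper Z) (upper W)))
    (r₁ E a b z w (e Z Z) (e W W)) (r₂ E a b n z w (e Z Z) (e Z W) (e W W)))
    where
    z = size Z
    w = size W
    r₁ : ∀ E a b z w p q → E * a * ((z + w) * (z + w)) + (E * b * p + E * b * q)
      ≡ 2 * (E * a * (z * w)) + (E * a * (z * z + w * w) + E * b * (p + q))
    r₁ = solve-∀
    r₂ : ∀ E a b n z w p m q → E * b * (p + 2 * m + q) + a * n * (z + w) +
        (E * a * (z * z) + a * n * z + (E * a * (w * w) + a * n * w))
      ≡ 2 * (E * b * m + a * n * (z + w)) + (E * a * (z * z + w * w) + E * b * (p + q))
    r₂ = solve-∀

  cut-upper : ∀ {X Z W} → Splits X Z W →
    E * b * e Z W ≤ E * a * (size Z * size W) + a * n * (size Z + size W)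
  cut-upper {X} {Z} {W} s = *-cancelˡ-≤ 2 (cancel-≤ _ _ (E * a * (z * z + w * w) + E * b * (e Z Z + e W W))
    (+-mono-≤ (subst₂ (λ k l → E * b * l ≤ E * a * (k * k) + a * n * k) (size-split s) (e-square s) (upper X))
      (+-mono-≤ (lower Z) (lower W)))
    (r₁ E a b z w (e Z Z) (e Z W) (e W W)) (r₂ E a b n z w (e Z Z) (e W W)))
    where
    z = size Z
    w = size W
    r₁ : ∀ E a b z w p m q → E * b * (p + 2 * m + q) + (E * a * (z * z) + E * a * (w * w))
      ≡ 2 * (E * b * m) + (E * a * (z * z + w * w) + E * b * (p + q))
    r₁ = solve-∀
    r₂ : ∀ E a b n z w p q → E * a * ((z + w) * (z + w)) + a * n * (z + w) +
        (E * b * p + a * n * z + (E * b * q + a * n * w))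
      ≡ 2 * (E * a * (z * w) + a * n * (z + w)) + (E * a * (z * z + w * w) + E * b * (p + q))
    r₂ = solve-∀

  size-∁ : ∀ (X : Subset n) → n ≡ size X + size (∁ X)
  size-∁ X = trans (sym (size-full n)) (size-split (split-full X))

  heavy : Subset n
  heavy x = does (D <? b * deg x)

  light-deg : ∀ x → heavy x ≡ false → b * deg x ≤ D
  light-deg x light = ≮⇒≥ (does-false (D <? b * deg x) light)

  -- Heavy vertices have over twice the typical degree, but the bounds for pairs inside `heavy` and
  -- across its boundary allow only a n |heavy| plus an error of a n (|heavy| + n) / E.
  few-heavy : E * size heavy ≤ 2 * n
  few-heavy = ≤-trans (*-cancelˡ-≤ (a * n) {{>-nonZero (m*n>0 0<a 0<n)}} main)
    (≤-trans (+-monoˡ-≤ n (size≤n heavy)) (≤-reflexive (r₀ n)))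
    where
    z = size heavy
    w = size (∁ heavy)
    r₀ : ∀ n → n + n ≡ 2 * n
    r₀ = solve-∀
    many : D * z ≤ b * e heavy full
    many = subst₂ _≤_ (sum-*ˡ D (χ ∘ heavy))
      (trans (sum-*ˡ b (λ x → χ (heavy x) * deg x)) (cong (b *_) (sym (e-full heavy)))) (sum-mono term)
      where
      term : ∀ x → D * χ (heavy x) ≤ b * (χ (heavy x) * deg x)
      term x with heavy x in hx
      ... | false rewrite *-zeroʳ D = z≤n
      ... | true  = subst₂ _≤_ (sym (*-identityʳ D)) (cong (b *_) (sym (*-identityˡ (deg x))))
                      (<⇒≤ (does-true (D <? b * deg x) hx))
    main : a * n * (E * z) ≤ a * n * (z + n)
    main = cancel-≤ _ _ (E * (b * e heavy full) + E * a * (n * z))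
      (+-mono-≤ (+-mono-≤ (*-monoʳ-≤ E many) (upper heavy)) (cut-upper (split-full heavy)))
      (trans (r₁ E a b n z (e heavy heavy) (e heavy (∁ heavy)))
        (cong (λ t → a * n * (E * z) + (E * (b * t) + E * a * (n * z))) (sym (e-splitʳ heavy (split-full heavy)))))
      (trans (r₂ E a b (e heavy full) z w n)
        (cong (λ t → a * n * (z + t) + (E * (b * e heavy full) + E * a * (t * z))) (sym (size-∁ heavy))))
      where
      r₁ : ∀ E a b n z p q → E * (2 * a * n * z) + E * b * p + E * b * q
        ≡ a * n * (E * z) + (E * (b * (p + q)) + E * a * (n * z))
      r₁ = solve-∀
      r₂ : ∀ E a b x z w n → E * (b * x) + (E * a * (z * z) + a * n * z) + (E * a * (z * w) + a * n * (z + w))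
        ≡ a * n * (z + (z + w)) + (E * (b * x) + E * a * ((z + w) * z))
      r₂ = solve-∀

  -- The trivial bound e(V,V) ≤ n² limits the density. It ensures that s = 1 is an admissible start
  -- of the search for s ≈ 1/√p.
  a≤2b : a ≤ 2 * b
  a≤2b = *-cancelˡ-≤ (E * (n * n)) {{>-nonZero (m*n>0 0<E (m*n>0 0<n 0<n))}} (cancel-≤ _ _
    (E * (a * (n * n)) + 2 * (a * (n * n)) + 2 * (E * b) * e full full)
    (+-mono-≤ (*-monoʳ-≤ 2 (subst₂ (λ k l → E * a * (k * k) ≤ E * b * l + a * n * k) (size-full n) refl (lower full)))
      (+-mono-≤ (*-monoʳ-≤ (2 * (E * b)) e≤n²) (*-monoˡ-≤ (a * (n * n)) 2≤E)))
    (r₁ E a b n (e full full)) (r₂ E a b n (e full full)))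
    where
    e≤n² : e full full ≤ n * n
    e≤n² = ≤-trans (sum₂-mono {n} {n} (λ x y → ≤-trans (≤-reflexive (r₃ (χ (adj G x y)))) (χ≤1 (adj G x y))))
      (≤-reflexive (trans (sum-cong {n} {λ _ → sumFin n (λ _ → 1)} {λ _ → n * 1} (λ x → trans (sum-one n) (sym (*-identityʳ n))))
        (trans (sum-*ˡ {n} n (λ _ → 1)) (cong (λ k → n * k) (sum-one n)))))
      where
      r₃ : ∀ c → 1 * (1 * c) ≡ c
      r₃ = solve-∀
    r₁ : ∀ E a b n x → 2 * (E * a * (n * n)) + (2 * (E * b) * x + 2 * (a * (n * n)))
      ≡ E * (n * n) * a + (E * (a * (n * n)) + 2 * (a * (n * n)) + 2 * (E * b) * x)
    r₁ = solve-∀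
    r₂ : ∀ E a b n x → 2 * (E * b * x + a * n * n) + (2 * (E * b) * (n * n) + E * (a * (n * n)))
      ≡ E * (n * n) * (2 * b) + (E * (a * (n * n)) + 2 * (a * (n * n)) + 2 * (E * b) * x)
    r₂ = solve-∀

  -- Isolated vertices form an independent set, so the lower bound allows at most n / E of them; all
  -- others contribute to e(V,V), so p cannot be far below 1/n. Consequently s = O(√n), and at least
  -- one branch set fits.
  b≤3an : b ≤ 3 * (a * n)
  b≤3an = *-cancelˡ-≤ (E * n) {{>-nonZero (m*n>0 0<E 0<n)}} (cancel-≤ _ _
      (E * n * b + 2 * (E * b) * i + 2 * b * n + 2 * (E * b) * x + 2 * (a * (n * n)))
      (+-mono-≤ (+-mono-≤ (*-monoʳ-≤ (2 * (E * b)) n≤i+x) (*-monoʳ-≤ (2 * b) isolated≤))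
        (+-mono-≤ (*-monoˡ-≤ (b * n) 2≤E) (+-mono-≤ (*-monoʳ-≤ 2 whole) (*-monoˡ-≤ (a * (n * n)) 2≤E))))
      (r₁ E a b n i x) (r₂ E a b n i x))
    where
    isolated : Subset n
    isolated x = does (deg x ≟ 0)
    i = size isolated
    x = e full full
    whole : E * b * x ≤ E * a * (n * n) + a * n * n
    whole = subst (λ k → E * b * x ≤ E * a * (k * k) + a * n * k) (size-full n) (upper full)
    no-edges : e isolated isolated ≡ 0
    no-edges = n≤0⇒n≡0 (≤-trans (e-mono {isolated} {isolated} {isolated} {full} (λ _ p → p) (λ _ _ → refl))
      (≤-reflexive (trans (e-full isolated) (trans (sum-cong term) (sum-zero n)))))
      where
      term : ∀ x → χ (isolated x) * deg x ≡ 0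
      term x with isolated x in eq
      ... | true  = trans (+-identityʳ _) (does-true (deg x ≟ 0) eq)
      ... | false = refl
    isolated≤ : E * i ≤ n
    isolated≤ with i ≟ 0
    ... | yes i≡0 = subst (_≤ n) (sym (trans (cong (E *_) i≡0) (*-zeroʳ E))) z≤n
    ... | no i≢0 = *-cancelˡ-≤ (a * i) {{>-nonZero (m*n>0 0<a (n≢0⇒n>0 i≢0))}}
      (subst₂ _≤_ (r₃ E a i) (trans (cong (λ t → E * b * t + a * n * i) no-edges) (r₄ (E * b) a n i)) (lower isolated))
      where
      r₃ : ∀ E a i → E * a * (i * i) ≡ a * i * (E * i)
      r₃ = solve-∀
      r₄ : ∀ c a n i → c * 0 + a * n * i ≡ a * i * n
      r₄ = solve-∀
    n≤i+x : n ≤ i + x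
    n≤i+x = subst₂ _≤_ (sum-one n) (trans (sum-+ {n} _ _) (cong (i +_) (sym (e-full full)))) (sum-mono term)
      where
      term : ∀ v → 1 ≤ χ (isolated v) + 1 * deg v
      term v with isolated v in eq
      ... | true  = s≤s z≤n
      ... | false = ≤-trans (n≢0⇒n>0 (does-false (deg v ≟ 0) eq)) (≤-reflexive (sym (*-identityˡ _)))
    r₁ : ∀ E a b n i x → 2 * (E * b) * n + 2 * b * (E * i) + (2 * (b * n) + (2 * (E * b * x) + 2 * (a * (n * n))))
      ≡ E * n * b + (E * n * b + 2 * (E * b) * i + 2 * b * n + 2 * (E * b) * x + 2 * (a * (n * n)))
    r₁ = solve-∀
    r₂ : ∀ E a b n i x → 2 * (E * b) * (i + x) + 2 * b * n +
        (E * (b * n) + (2 * (E * a * (n * n) + a * n * n) + E * (a * (n * n))))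
      ≡ E * n * (3 * (a * n)) + (E * n * b + 2 * (E * b) * i + 2 * b * n + 2 * (E * b) * x + 2 * (a * (n * n)))
    r₂ = solve-∀

  module Pruning (R : Subset n) (R-large : 4 * n ≤ 5 * size R) where

    Sparse : Subset n → Subset n → Set
    Sparse S Z = 10 * (b * e Z (S ∩ ∁ Z)) ≤ D * size Z

    -- Up to error, jumbledness forces 3/10 of p n |Z| edges from Z to the rest, while sparseness
    -- allows 2/10. The error must cover the difference, which bounds |Z|.
    sparse⇒small : ∀ Z → Z ⊆ R → Sparse R Z → 3 * n ≤ 10 * size (R ∩ ∁ Z) → E * size Z ≤ 10 * n
    sparse⇒small Z Z⊆R sparse rest = *-cancelˡ-≤ (a * n) {{>-nonZero (m*n>0 0<a 0<n)}} (cancel-≤ _ _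
      (E * (10 * (b * x)) + E * (2 * a * n * z) + 10 * (E * a * (z * w)) + 10 * (a * n * (z + w)))
      (+-mono-≤ (*-monoʳ-≤ (E * a * z) rest) (+-mono-≤ (*-monoʳ-≤ 10 (cut-lower (split-⊆ Z⊆R)))
        (+-mono-≤ (*-monoʳ-≤ E sparse) (*-monoʳ-≤ (10 * (a * n)) z+w≤n))))
      (r₁ E a b n z w x) (r₂ E a b n z w x))
      where
      z = size Z
      w = size (R ∩ ∁ Z)
      x = e Z (R ∩ ∁ Z)
      z+w≤n : z + w ≤ n
      z+w≤n = ≤-trans (≤-reflexive (sym (size-split (split-⊆ Z⊆R)))) (size≤n R)
      r₁ : ∀ E a b n z w x → E * a * z * (3 * n) + (10 * (E * a * (z * w)) + (E * (10 * (b * x)) + 10 * (a * n) * (z + w)))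
        ≡ a * n * (E * z) + (E * (10 * (b * x)) + E * (2 * a * n * z) + 10 * (E * a * (z * w)) + 10 * (a * n * (z + w)))
      r₁ = solve-∀
      r₂ : ∀ E a b n z w x → E * a * z * (10 * w) + (10 * (E * b * x + a * n * (z + w)) + (E * (2 * a * n * z) + 10 * (a * n) * n))
        ≡ a * n * (10 * n) + (E * (10 * (b * x)) + E * (2 * a * n * z) + 10 * (E * a * (z * w)) + 10 * (a * n * (z + w)))
      r₂ = solve-∀

    Expanding : Subset n → Set
    Expanding W = ∀ X → X ⊆ W → 2 * size X ≤ size W → D * size X ≤ 10 * (b * e X (W ∩ ∁ X))

    Cut : Subset n → Subset n → Set
    Cut S X = X ⊆ S × 0 < size X × 2 * size X ≤ size S × Sparse S X

    cut? : ∀ S → (∃[ X ] Cut S X) ⊎ (∀ X → ¬ Cut S X)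
    cut? S = search (Cut S)
      (λ {X} {Y} X≗Y (sub , pos , half , sparse) →
        let size≡ = sum-cong (λ i → cong χ (X≗Y i)) in
        (λ i Yi → sub i (trans (X≗Y i) Yi)) , subst (0 <_) size≡ pos , subst (λ k → 2 * k ≤ size S) size≡ half ,
        subst₂ (λ k l → 10 * (b * k) ≤ D * l) (e-cong X≗Y (λ i → cong (λ v → S i ∧ not v) (X≗Y i))) size≡ sparse)
      (λ X → all? (λ i → (X i Bool.≟ true) →-dec (S i Bool.≟ true)) ×-dec (0 <? size X) ×-dec
        (2 * size X ≤? size S) ×-dec (10 * (b * e X (S ∩ ∁ X)) ≤? D * size X))

    -- Sparse cuts are removed one by one. Their union Z stays sparse in R, hence small; each cut
    -- takes at most half of what is left, so Z never jumps past the range where `sparse⇒small`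
    -- applies.
    prune : ∀ fuel Z → Z ⊆ R → Sparse R Z → E * size Z ≤ 10 * n → n < size Z + fuel →
      ∃[ W ] (W ⊆ R × E * size R ≤ E * size W + 10 * n × Expanding W)
    prune zero Z _ _ _ n< = contradiction (size≤n Z) (<⇒≱ (subst (n <_) (+-identityʳ _) n<))
    prune (suc fuel) Z Z⊆R sparse small n< with cut? (R ∩ ∁ Z)
    ... | inj₂ none = S , (λ i p → proj₁ (∧-elim (R i) p)) ,
      ≤-trans (≤-reflexive (trans (cong (E *_) (trans (size-split (split-⊆ Z⊆R)) (+-comm (size Z) (size S))))
        (*-distribˡ-+ E (size S) _)))
        (+-monoʳ-≤ (E * size S) small) , expanding
      where
      S = R ∩ ∁ Z
      expanding : Expanding S
      expanding X X⊆S half with 0 <? size X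
      ... | no ≯0 = ≤-trans (≤-reflexive (trans (cong (D *_) (n≤0⇒n≡0 (≮⇒≥ ≯0))) (*-zeroʳ D))) z≤n
      ... | yes pos with 10 * (b * e X (S ∩ ∁ X)) ≤? D * size X
      ...   | yes sp = contradiction (X⊆S , pos , half , sp) (none X)
      ...   | no dense = <⇒≤ (≰⇒> dense)
    ... | inj₁ (X , X⊆S , pos , half , sparseX) =
      prune fuel Z′ Z′⊆R sparse′ (sparse⇒small Z′ Z′⊆R sparse′ rest) (begin-strict
        n                         <⟨ n< ⟩
        size Z + suc fuel         ≡⟨ +-assoc (size Z) 1 fuel ⟨
        size Z + 1 + fuel         ≤⟨ +-monoˡ-≤ fuel (+-monoʳ-≤ (size Z) pos) ⟩
        size Z + size X + fuel    ≡⟨ cong (_+ fuel) (size-split splitZ′) ⟨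
        size Z′ + fuel ∎)
      where
      open ≤-Reasoning
      S = R ∩ ∁ Z
      Z′ = Z ∪ X
      Z′⊆R : Z′ ⊆ R
      Z′⊆R i p with ∨-elim (Z i) p
      ... | inj₁ Zi = Z⊆R i Zi
      ... | inj₂ Xi = proj₁ (∧-elim (R i) (X⊆S i Xi))
      splitZ′ : Splits Z′ Z X
      splitZ′ = splits disjoint
        where
        disjoint : ∀ i → χ (Z′ i) ≡ χ (Z i) + χ (X i)
        disjoint i with Z i in Zi | X i in Xi
        ... | false | _ = refl
        ... | true | false = refl
        ... | true | true = contradiction (trans (sym Zi) (not-true (proj₂ (∧-elim (R i) (X⊆S i Xi))))) λ ()
      sub₁ : (R ∩ ∁ Z′) ⊆ (R ∩ ∁ Z)
      sub₁ i p with R i | Z i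
      ... | true | false = refl
      sub₂ : (R ∩ ∁ Z′) ⊆ (S ∩ ∁ X)
      sub₂ i p with R i | Z i
      ... | true | false = p
      sparse′ : Sparse R Z′
      sparse′ = begin
        10 * (b * e Z′ (R ∩ ∁ Z′))
          ≡⟨ cong (λ t → 10 * (b * t)) (e-splitˡ (R ∩ ∁ Z′) splitZ′) ⟩
        10 * (b * (e Z (R ∩ ∁ Z′) + e X (R ∩ ∁ Z′)))
          ≤⟨ *-monoʳ-≤ 10 (*-monoʳ-≤ b (+-mono-≤ (e-mono {Z} (λ _ p → p) sub₁) (e-mono {X} (λ _ p → p) sub₂))) ⟩
        10 * (b * (e Z (R ∩ ∁ Z) + e X (S ∩ ∁ X)))            ≡⟨ r₁ b (e Z (R ∩ ∁ Z)) (e X (S ∩ ∁ X)) ⟩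
        10 * (b * e Z (R ∩ ∁ Z)) + 10 * (b * e X (S ∩ ∁ X))   ≤⟨ +-mono-≤ sparse sparseX ⟩
        D * size Z + D * size X                               ≡⟨ *-distribˡ-+ D (size Z) (size X) ⟨
        D * (size Z + size X)                                 ≡⟨ cong (D *_) (size-split splitZ′) ⟨
        D * size Z′ ∎
        where
        r₁ : ∀ b p q → 10 * (b * (p + q)) ≡ 10 * (b * p) + 10 * (b * q)
        r₁ = solve-∀
      -- |S| = |X| + |R \ Z′| ≤ 2 |R \ Z′|, and |S| = |R| − |Z| ≥ 3n/5.
      rest : 3 * n ≤ 10 * size (R ∩ ∁ Z′)
      rest = *-cancelˡ-≤ 10 (cancel-≤ _ _ (10 * n + 50 * size Z + 50 * size S)
        (+-mono-≤ (*-monoʳ-≤ 10 (subst (λ k → 4 * n ≤ 5 * k) (size-split (split-⊆ Z⊆R)) R-large))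
          (+-mono-≤ (≤-trans (*-monoˡ-≤ (size Z) 50≤E) small) (*-monoʳ-≤ 50 S≤2w)))
        (r₁ n (size Z) (size S)) (r₂ n (size Z) (size S) w))
        where
        w = size (R ∩ ∁ Z′)
        S≡X+w : size S ≡ size X + w
        S≡X+w = +-cancelˡ-≡ (size Z) _ _ (trans (sym (size-split (split-⊆ Z⊆R)))
          (trans (size-split (split-⊆ Z′⊆R)) (trans (cong (_+ w) (size-split splitZ′)) (+-assoc (size Z) _ _))))
        S≤2w : size S ≤ 2 * w
        S≤2w = cancel-≤ _ _ (size S + 2 * size X)
          (+-mono-≤ half (≤-reflexive (cong (2 *_) S≡X+w))) (r₃ (size S) (size X)) (r₄ (size S) (size X) w)
          where
          r₃ : ∀ s x → 2 * x + 2 * s ≡ s + (s + 2 * x)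
          r₃ = solve-∀
          r₄ : ∀ s x w → s + 2 * (x + w) ≡ 2 * w + (s + 2 * x)
          r₄ = solve-∀
        r₁ : ∀ n z s → 10 * (4 * n) + (50 * z + 50 * s) ≡ 10 * (3 * n) + (10 * n + 50 * z + 50 * s)
        r₁ = solve-∀
        r₂ : ∀ n z s w → 10 * (5 * (z + s)) + (10 * n + 50 * (2 * w))
          ≡ 10 * (10 * w) + (10 * n + 50 * z + 50 * s)
        r₂ = solve-∀

    pruned : ∃[ W ] (W ⊆ R × E * size R ≤ E * size W + 10 * n × Expanding W)
    pruned = prune (suc n) (λ _ → false) (λ _ ()) start
      (subst (λ k → E * k ≤ 10 * n) (sym (sum-zero n)) (subst (_≤ 10 * n) (sym (*-zeroʳ E)) z≤n)) (m≤n+m (suc n) _)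
      where
      start : Sparse R (λ _ → false)
      start = ≤-trans (≤-reflexive (trans (cong (λ t → 10 * (b * t))
        (trans (sum-cong {n} {λ _ → sumFin n (λ _ → 0)} {λ _ → 0} (λ x → sum-zero n)) (sum-zero n)))
        (cong (10 *_) (*-zeroʳ b)))) z≤n

χ-some≤sum : ∀ {n} (X : Subset n) → χ (some X) ≤ size X
χ-some≤sum {zero}  X = z≤n
χ-some≤sum {suc n} X with X zero
... | true  = s≤s z≤n
... | false = χ-some≤sum (X ∘ suc)

-- Jumbledness is used with error 1/E, at most n/h vertices are ever covered by branch sets,
-- and c = 4 L (2 L + 1) for the expansion constant L = 10.
module Regions {n : ℕ} (G : Graph n) (a b E h c : ℕ) (0<a : 0 < a) (0<b : 0 < b) (0<n : 0 < n) (50≤E : 50 ≤ E)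
  (upper : ∀ X → E * b * Edges.e G X X ≤ E * a * (size X * size X) + a * n * size X)
  (lower : ∀ X → E * a * (size X * size X) ≤ E * b * Edges.e G X X + a * n * size X)
  (E≡12h : E ≡ 12 * h) (h≡80c : h ≡ 80 * c) (c≡ : c ≡ 4 * 10 * (2 * 10 + 1))
  where
  open Edges G public
  open Pseudorandom G a b E 0<a 0<b 0<n 50≤E upper lower public

  module Lazy (W : Subset n) (light : W ⊆ ∁ heavy) where

    inW : Fin n → Fin n → Bool
    inW x y = W x ∧ W y ∧ adj G x y

    degW slack : Fin n → ℕ
    degW x = sumFin n (χ ∘ inW x)
    slack x = D ∸ b * degW x

    -- The adjacency matrix of G[W] scaled by b, with loops making all row sums equal to D.
    A : Fin n → Fin n → ℕ
    A x y = b * χ (inW x y) + χ (⁅ x ⁆ y) * slack x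

    A-sym : ∀ x y → A x y ≡ A y x
    A-sym x y = cong₂ _+_ (cong (λ v → b * χ v) edge) loop
      where
      edge : inW x y ≡ inW y x
      edge with W x | W y
      ... | true  | true  = adj-sym G x y
      ... | true  | false = refl
      ... | false | true  = refl
      ... | false | false = refl
      loop : χ (⁅ x ⁆ y) * slack x ≡ χ (⁅ y ⁆ x) * slack y
      loop with ⁅ x ⁆ y in p | ⁅ y ⁆ x in q
      ... | true  | true  = cong (λ v → 1 * slack v) (does-true (x Fin.≟ y) p)
      ... | false | false = refl
      ... | true  | false = contradiction (sym (does-true (x Fin.≟ y) p)) (does-false (y Fin.≟ x) q)
      ... | false | true  = contradiction (sym (does-true (y Fin.≟ x) q)) (does-false (x Fin.≟ y) p)

    -- Vertices of W are light and the others have no neighbours in the walk, so the truncated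
    -- subtraction in `slack` is exact.
    degW≤D : ∀ x → b * degW x ≤ D
    degW≤D x with W x in Wx
    ... | false = ≤-trans (≤-reflexive (trans (cong (b *_) (sum-zero n)) (*-zeroʳ b))) z≤n
    ... | true  = ≤-trans (*-monoʳ-≤ b (sum-mono (λ y → χ-mono (λ p → proj₂ (∧-elim (W y) p)))))
                    (light-deg x (not-true (light x Wx)))

    row : ∀ x → sumFin n (A x) ≡ D
    row x = trans (sum-+ {n} _ _) (trans (cong₂ _+_ (sum-*ˡ b (χ ∘ inW x)) (sum-delta x (λ _ → slack x)))
      (m+[n∸m]≡n (degW≤D x)))

    along : ∀ x y → 0 < A x y → x ≡ y ⊎ (W x ≡ true × W y ≡ true × adj G x y ≡ true)
    along x y pos with inW x y in p
    ... | true = let Wx , q = ∧-elim (W x) p ; Wy , xy = ∧-elim (W y) q in inj₂ (Wx , Wy , xy)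
    ... | false with ⁅ x ⁆ y in q
    ...   | true  = inj₁ (does-true (x Fin.≟ y) q)
    ...   | false = contradiction (subst (0 <_) (trans (+-identityʳ _) (*-zeroʳ b)) pos) λ ()

    open Network A A-sym D row using (capacity)

    capacity-lower : ∀ X → X ⊆ W → b * e X (W ∩ ∁ X) ≤ capacity X
    capacity-lower X X⊆W = ≤-trans (≤-reflexive (sym (sum₂-*ˡ {n} {n} b _))) (sum₂-mono term)
      where
      term : ∀ x y → b * (χ (X x) * (χ (W y ∧ not (X y)) * χ (adj G x y))) ≤ χ (X x) * (χ (not (X y)) * A x y)
      term x y with X x in Xx
      ... | false rewrite *-zeroʳ b = z≤n
      ... | true with W y in Wy | X y
      ...   | false | _    rewrite *-zeroʳ b = z≤n
      ...   | true  | true rewrite *-zeroʳ b = z≤n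
      ...   | true  | false rewrite X⊆W x Xx =
              ≤-trans (≤-reflexive (r₁ b (χ (adj G x y)))) (≤-trans (m≤m+n _ _) (≤-reflexive (r₂ _)))
        where
        r₁ : ∀ b v → b * (1 * (1 * v)) ≡ b * v
        r₁ = solve-∀
        r₂ : ∀ v → v ≡ 1 * (1 * v)
        r₂ = solve-∀

  -- `grow` is the hitting bound freed of the lazy walk; targets may leave W, but only their parts
  -- in W count on the left. The 8 n arises from |N j| ≤ 2 s p n and s² p ≤ 4.
  record Region (U : Subset n) : Set where
    field
      W       : Subset n
      avoids  : W ⊆ ∁ U
      light   : W ⊆ ∁ heavy
      cosmall : h * size (∁ W) ≤ 2 * n
      large   : 4 * n ≤ 5 * size W
      grow    : ∀ {k} (N : Fin k → Subset n) t → (∀ j → suc t * size (N j) ≤ 8 * n) → ∃[ T ]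
        (ConnectedIn G T × T ⊆ W × size T ≤ suc t ×
         suc t * sumFin k (λ j → size (N j ∩ W)) ≤ c * n * sumFin k (λ j → χ (meets T (N j))))

  10≤h : 10 ≤ h
  10≤h = subst (10 ≤_) (sym (trans h≡80c (cong (80 *_) c≡))) (m≤m+n 10 67190)

  -- Heavy vertices cost 2 n / E and pruning costs 10 n / E, together n / h because E = 12 h. With
  -- |U| ≤ n / h this gives the 2 n / h in `cosmall`.
  region : ∀ U → h * size U ≤ n → Region U
  region U U-small = assemble (Pruning.pruned R R-large)
    where
    R = ∁ (U ∪ heavy)
    u = size U
    v = size heavy
    n≤ : n ≤ u + v + size R
    n≤ = ≤-trans (≤-reflexive (size-∁ (U ∪ heavy))) (+-monoˡ-≤ (size R) (size-∪ U heavy))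
    R-large : 4 * n ≤ 5 * size R
    R-large = *-cancelˡ-≤ 10 (cancel-≤ _ _ (10 * n + 50 * u + 50 * v)
      (+-mono-≤ (*-monoʳ-≤ 50 n≤) (+-mono-≤ (*-monoʳ-≤ 5 (≤-trans (*-monoˡ-≤ u 10≤h) U-small))
        (≤-trans (*-monoˡ-≤ v 50≤E) (≤-trans few-heavy (*-monoˡ-≤ n (m≤m+n 2 3))))))
      (r₁ n u v) (r₂ n u v (size R)))
      where
      r₁ : ∀ n u v → 50 * n + (5 * (10 * u) + 50 * v) ≡ 10 * (4 * n) + (10 * n + 50 * u + 50 * v)
      r₁ = solve-∀
      r₂ : ∀ n u v r → 50 * (u + v + r) + (5 * n + 5 * n) ≡ 10 * (5 * r) + (10 * n + 50 * u + 50 * v)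
      r₂ = solve-∀
    assemble : ∃[ W ] (W ⊆ R × E * size R ≤ E * size W + 10 * n × Pruning.Expanding R R-large W) → Region U
    assemble (W , W⊆R , big , expanding) = record
      { W = W
      ; avoids = λ x Wx → proj₁ (outside x Wx)
      ; light = light
      ; cosmall = cosmall
      ; large = large
      ; grow = grow
      }
      where
      w = size W
      w′ = size (∁ W)
      outside : ∀ x → W x ≡ true → not (U x) ≡ true × not (heavy x) ≡ true
      outside x Wx with U x | heavy x | W⊆R x Wx
      ... | false | false | _ = refl , refl
      light : W ⊆ ∁ heavy
      light x Wx = proj₂ (outside x Wx)
      cosmall : h * w′ ≤ 2 * n
      cosmall = *-cancelˡ-≤ 12 (begin
        12 * (h * w′)        ≡⟨ 12h w′ ⟩
        E * w′               ≤⟨ cancel-≤ _ _ (E * w + E * size R + E * v)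
          (+-mono-≤ (*-monoʳ-≤ E n≤) (+-mono-≤ big few-heavy))
          (trans (cong (λ k → E * k + (E * size R + E * v)) (size-∁ W)) (r₁ E w w′ (size R) v))
          (r₂ E u v (size R) w n) ⟩
        E * u + 12 * n       ≡⟨ cong (_+ 12 * n) (12h u) ⟨
        12 * (h * u) + 12 * n ≤⟨ +-monoˡ-≤ (12 * n) (*-monoʳ-≤ 12 U-small) ⟩
        12 * n + 12 * n      ≡⟨ r₃ n ⟩
        12 * (2 * n) ∎)
        where
        open ≤-Reasoning
        12h : ∀ k → 12 * (h * k) ≡ E * k
        12h k = trans (sym (*-assoc 12 h k)) (cong (_* k) (sym E≡12h))
        r₁ : ∀ E w w′ r v → E * (w + w′) + (E * r + E * v) ≡ E * w′ + (E * w + E * r + E * v)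
        r₁ = solve-∀
        r₂ : ∀ E u v r w n → E * (u + v + r) + (E * w + 10 * n + 2 * n)
          ≡ E * u + 12 * n + (E * w + E * r + E * v)
        r₂ = solve-∀
        r₃ : ∀ n → 12 * n + 12 * n ≡ 12 * (2 * n)
        r₃ = solve-∀
      large : 4 * n ≤ 5 * w
      large = *-cancelˡ-≤ 2 (cancel-≤ _ _ (2 * n + 10 * w′)
        (+-mono-≤ (≤-trans (*-monoˡ-≤ w′ 10≤h) cosmall) (≤-reflexive (cong (10 *_) (size-∁ W))))
        (r₁ n w′) (r₂ n w w′))
        where
        r₁ : ∀ n w′ → 10 * w′ + 10 * n ≡ 2 * (4 * n) + (2 * n + 10 * w′)
        r₁ = solve-∀
        r₂ : ∀ n w w′ → 2 * n + 10 * (w + w′) ≡ 2 * (5 * w) + (2 * n + 10 * w′)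
        r₂ = solve-∀
      open Lazy W light
      expand : ∀ X → X ⊆ W → 2 * size X ≤ w → D * size X ≤ 10 * Network.capacity A A-sym D row X
      expand X X⊆W half = ≤-trans (expanding X X⊆W half) (*-monoʳ-≤ 10 (capacity-lower X X⊆W))
      grow : ∀ {k} (N : Fin k → Subset n) t → (∀ j → suc t * size (N j) ≤ 8 * n) → ∃[ T ]
        (ConnectedIn G T × T ⊆ W × size T ≤ suc t ×
         suc t * sumFin k (λ j → size (N j ∩ W)) ≤ c * n * sumFin k (λ j → χ (meets T (N j))))
      grow {k} N t short = finish (Trails.block G A A-sym D row W 0<D along (λ j → N j ∩ W) 10 w z<s 0<w expand
        (λ j x p → proj₂ (∧-elim (N j x) p)) t short′)
        where
        open ≤-Reasoning
        0<w : 0 < w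
        0<w = proj₂ (factors>0 5 w (≤-trans (m*n>0 {4} z<s 0<n) large))
        short′ : ∀ j → 4 * (suc t * size (N j ∩ W)) ≤ 4 * 10 * (2 * 10 + 1) * w
        short′ j = begin
          4 * (suc t * size (N j ∩ W))
            ≤⟨ *-monoʳ-≤ 4 (*-monoʳ-≤ (suc t) (size-mono {X = N j ∩ W} {N j} (λ x p → proj₁ (∧-elim (N j x) p)))) ⟩
          4 * (suc t * size (N j))     ≤⟨ *-monoʳ-≤ 4 (short j) ⟩
          4 * (8 * n)                  ≡⟨ r₁ n ⟩
          8 * (4 * n)                  ≤⟨ *-monoʳ-≤ 8 large ⟩
          8 * (5 * w)                  ≡⟨ *-assoc 8 5 w ⟨
          40 * w                       ≤⟨ *-monoˡ-≤ w (m≤m+n 40 800) ⟩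
          840 * w ∎
          where
          r₁ : ∀ n → 4 * (8 * n) ≡ 8 * (4 * n)
          r₁ = solve-∀
        finish : ∃[ T ] (ConnectedIn G T × T ⊆ W × size T ≤ suc t ×
          suc t * sumFin k (λ j → size (N j ∩ W)) ≤ 4 * 10 * (2 * 10 + 1) * w * sumFin k (λ j → χ (meets T (N j ∩ W)))) → _
        finish (T , conn , T⊆W , T≤ , hits) = T , conn , T⊆W , T≤ ,
          ≤-trans (subst (λ C → suc t * sumFin k (λ j → size (N j ∩ W)) ≤ C * w * sumFin k (λ j → χ (meets T (N j ∩ W))))
              (sym c≡) hits)
            (*-mono-≤ (*-monoʳ-≤ c (size≤n W)) (sum-mono (λ j → χ-mono (meets-mono j))))
          where
          meets-mono : ∀ j → meets T (N j ∩ W) ≡ true → meets T (N j) ≡ true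
          meets-mono j p = let x , q = some-elim (T ∩ (N j ∩ W)) p
                               Tx , NWx = ∧-elim (T x) q
                           in some-intro (T ∩ N j) x (∧-intro Tx (proj₁ (∧-elim (N j x) NWx)))

-- Packing disjoint sets and contracting them

two≤sum : ∀ {k} (f : Fin k → ℕ) i j → i ≢ j → f i + f j ≤ sumFin k f
two≤sum f zero zero i≢j = contradiction refl i≢j
two≤sum f zero (suc j) _ = +-monoʳ-≤ (f zero) (term≤sum (f ∘ suc) j)
two≤sum f (suc i) zero _ = ≤-trans (≤-reflexive (+-comm (f (suc i)) (f zero))) (+-monoʳ-≤ (f zero) (term≤sum (f ∘ suc) i))
two≤sum f (suc i) (suc j) i≢j = ≤-trans (two≤sum (f ∘ suc) i j (i≢j ∘ cong suc)) (m≤n+m _ (f zero))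

-- Greedy choice. The one inequality on indicators says that the B i are disjoint from each other
-- and from U and that all lie in U′. Carrying U₀ lets the second phase know that its used set still
-- contains the sets of the first.
pack : ∀ {n} (h s : ℕ) (Good : Subset n → Set) (U₀ : Subset n) →
  (∀ U → U₀ ⊆ U → h * size U ≤ n → ∃[ T ] (Good T × T ⊆ ∁ U × size T ≤ s)) →
  ∀ m U → U₀ ⊆ U → h * (size U + m * s) ≤ n →
  Σ (Fin m → Subset n) λ B → ∃[ U′ ]
    ((∀ i → Good (B i)) × (∀ x → sumFin m (λ i → χ (B i x)) + χ (U x) ≤ χ (U′ x)) × size U′ ≤ size U + m * s)
pack h s Good U₀ choose zero U _ _ = (λ ()) , U , (λ ()) , (λ _ → ≤-refl) , m≤m+n _ _
pack {n} h s Good U₀ choose (suc m) U U₀⊆U room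
  with choose U U₀⊆U (≤-trans (*-monoʳ-≤ h (m≤m+n _ _)) room)
... | T , good , T⊆∁U , T≤
  with pack h s Good U₀ choose m (U ∪ T) (λ x p → ∨-introˡ _ (U₀⊆U x p)) (≤-trans (*-monoʳ-≤ h used) room)
  where
  used : size (U ∪ T) + m * s ≤ size U + suc m * s
  used = ≤-trans (+-monoˡ-≤ (m * s) (≤-trans (size-∪ U T) (+-monoʳ-≤ (size U) T≤)))
    (≤-reflexive (+-assoc (size U) s (m * s)))
...   | B , U′ , goods , cover , U′≤ = B′ , U′ , goods′ , cover′ ,
  ≤-trans U′≤ (≤-trans (+-monoˡ-≤ (m * s) (≤-trans (size-∪ U T) (+-monoʳ-≤ (size U) T≤)))
    (≤-reflexive (+-assoc (size U) s (m * s))))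
  where
  B′ : Fin (suc m) → Subset n
  B′ zero    = T
  B′ (suc i) = B i
  goods′ : ∀ i → Good (B′ i)
  goods′ zero    = good
  goods′ (suc i) = goods i
  cover′ : ∀ x → χ (T x) + sumFin m (λ i → χ (B i x)) + χ (U x) ≤ χ (U′ x)
  cover′ x = ≤-trans (≤-reflexive (r₁ (χ (T x)) (sumFin m (λ i → χ (B i x))) (χ (U x))))
    (≤-trans (+-monoʳ-≤ (sumFin m (λ i → χ (B i x))) disjoint) (cover x))
    where
    r₁ : ∀ t b u → t + b + u ≡ b + (u + t)
    r₁ = solve-∀
    disjoint : χ (U x) + χ (T x) ≤ χ (U x ∨ T x)
    disjoint with U x in Ux | T x in Tx
    ... | false | _     = ≤-refl
    ... | true  | false = ≤-refl
    ... | true  | true  = contradiction (trans (sym Ux) (not-true (T⊆∁U x Tx))) λ ()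

module Contraction {n k : ℕ} (G : Graph n) (B : Fin k → Subset n)
  (connected : ∀ u → ConnectedIn G (B u)) (packed : ∀ x → sumFin k (λ u → χ (B u x)) ≤ 1) where

  touches : Fin k → Fin k → Bool
  touches u v = meets (B v) (λ y → some (λ x → B u x ∧ adj G x y))

  quotient : Graph k
  quotient = record
    { adj    = λ u v → not (⁅ u ⁆ v ∨ ⁅ v ⁆ u) ∧ (touches u v ∨ touches v u)
    ; sym    = λ u v → cong₂ (λ p q → not p ∧ q) (∨-comm (⁅ u ⁆ v) _) (∨-comm (touches u v) _)
    ; irrefl = λ u → cong (λ p → not (p ∨ p) ∧ (touches u u ∨ touches u u)) (true-does (u Fin.≟ u) refl)
    }

  disjoint : ∀ u v x → B u x ≡ true → B v x ≡ true → u ≡ v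
  disjoint u v x Bu Bv with u Fin.≟ v
  ... | yes u≡v = u≡v
  ... | no u≢v = contradiction (≤-trans (≤-reflexive (cong₂ (λ p q → χ p + χ q) (sym Bu) (sym Bv)))
                   (≤-trans (two≤sum (λ w → χ (B w x)) u v u≢v) (packed x))) λ { (s≤s ()) }

  touching : ∀ u v → touches u v ≡ true → ∃[ x ] ∃[ y ] (B u x ≡ true × B v y ≡ true × adj G x y ≡ true)
  touching u v t =
    let y , p = some-elim (B v ∩ (λ y → some (λ x → B u x ∧ adj G x y))) t
        Bvy , q = ∧-elim (B v y) p
        x , r = some-elim (λ x → B u x ∧ adj G x y) q
        Bux , xy = ∧-elim (B u x) r
    in x , y , Bux , Bvy , xy

  quotient-minor : IsMinorOf quotient G
  quotient-minor = record
    { B = B ; connected = connected ; disjoint = disjoint ; edges = edges }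
    where
    edges : ∀ u v → adj quotient u v ≡ true → ∃[ x ] ∃[ y ] (B u x ≡ true × B v y ≡ true × adj G x y ≡ true)
    edges u v uv with ∨-elim (touches u v) (proj₂ (∧-elim (not (⁅ u ⁆ v ∨ ⁅ v ⁆ u)) uv))
    ... | inj₁ t = touching u v t
    ... | inj₂ t = let x , y , Bvx , Buy , xy = touching v u t in y , x , Buy , Bvx , trans (adj-sym G y x) xy

module Bipartite {n m : ℕ} (G : Graph n) (B C : Fin m → Subset n)
  (B-connected : ∀ i → ConnectedIn G (B i)) (C-connected : ∀ j → ConnectedIn G (C j))
  (packed : ∀ x → sumFin m (λ i → χ (B i x)) + sumFin m (λ j → χ (C j x)) ≤ 1) where

  both : Fin (m + m) → Subset n
  both u = [ B , C ]′ (splitAt m u)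

  both-connected : ∀ u → ConnectedIn G (both u)
  both-connected u with splitAt m u
  ... | inj₁ i = B-connected i
  ... | inj₂ j = C-connected j

  bothˡ : ∀ i → both (i ↑ˡ m) ≡ B i
  bothˡ i = cong [ B , C ]′ (splitAt-↑ˡ m i m)

  bothʳ : ∀ j → both (m ↑ʳ j) ≡ C j
  bothʳ j = cong [ B , C ]′ (splitAt-↑ʳ m m j)

  both-packed : ∀ x → sumFin (m + m) (λ u → χ (both u x)) ≤ 1
  both-packed x = ≤-trans (≤-reflexive (trans (sum-split m (λ u → χ (both u x)))
    (cong₂ _+_ (sum-cong (λ i → cong (λ S → χ (S x)) (bothˡ i))) (sum-cong (λ j → cong (λ S → χ (S x)) (bothʳ j)))))) (packed x)

  open Contraction G both both-connected both-packed public

  -- Indices of B precede those of C, so each touching pair (i, j) is counted in its increasing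
  -- orientation; pairs within B or within C are discarded.
  many-edges : sum₂ (λ i j → χ (meets (C j) (λ y → some (λ x → B i x ∧ adj G x y)))) ≤ eAll quotient
  many-edges = begin
    sum₂ (λ i j → χ (meets (C j) (λ y → some (λ x → B i x ∧ adj G x y))))  ≤⟨ sum₂-mono term ⟩
    sumFin m (λ i → sumFin m (λ j → below (i ↑ˡ m) (m ↑ʳ j)))
      ≤⟨ sum-mono (λ i → ≤-trans (m≤n+m _ _) (≤-reflexive (sym (sum-split m (below (i ↑ˡ m)))))) ⟩
    sumFin m (λ i → sumFin (m + m) (below (i ↑ˡ m)))
      ≤⟨ ≤-trans (m≤m+n _ _) (≤-reflexive (sym (sum-split m (λ u → sumFin (m + m) (below u))))) ⟩
    eAll quotient ∎
    where
    open ≤-Reasoning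
    below : Fin (m + m) → Fin (m + m) → ℕ
    below u v = χ (adj quotient u v ∧ (toℕ u <ᵇ toℕ v))
    term : ∀ i j → χ (meets (C j) (λ y → some (λ x → B i x ∧ adj G x y))) ≤ below (i ↑ˡ m) (m ↑ʳ j)
    term i j = χ-mono λ t → ∧-intro (∧-intro (cong not (distinct (i ↑ˡ m) (m ↑ʳ j) ordered)) (∨-introˡ _ (touch t))) (lt→ ordered)
      where
      ordered : toℕ (i ↑ˡ m) < toℕ (m ↑ʳ j)
      ordered = subst₂ _<_ (sym (toℕ-↑ˡ i m)) (sym (toℕ-↑ʳ m j)) (≤-trans (toℕ<n i) (m≤m+n m (toℕ j)))
      lt→ : ∀ {p q} → p < q → (p <ᵇ q) ≡ true
      lt→ {p} {q} p<q with p <ᵇ q in eq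
      ... | true = refl
      ... | false = contradiction (subst Bool.T eq (<⇒<ᵇ p<q)) λ ()
      distinct : ∀ (u v : Fin (m + m)) → toℕ u < toℕ v → ⁅ u ⁆ v ∨ ⁅ v ⁆ u ≡ false
      distinct u v u<v with ⁅ u ⁆ v in p | ⁅ v ⁆ u in q
      ... | false | false = refl
      ... | true  | _    = contradiction (cong toℕ (does-true (u Fin.≟ v) p)) (<⇒≢ u<v)
      ... | false | true = contradiction (cong toℕ (sym (does-true (v Fin.≟ u) q))) (<⇒≢ u<v)
      touch : meets (C j) (λ y → some (λ x → B i x ∧ adj G x y)) ≡ true → touches (i ↑ˡ m) (m ↑ʳ j) ≡ true
      touch = subst₂ (λ S S′ → meets S′ (λ y → some (λ x → S x ∧ adj G x y)) ≡ true) (sym (bothˡ i)) (sym (bothʳ j))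

-- The walk length and the two phases

integer-sqrt : ∀ a b → 0 < a → a ≤ 4 * b → ∃[ t ] (suc t * suc t * a ≤ 4 * b × b ≤ suc t * suc t * a)
integer-sqrt a b 0<a a≤4b = climb (4 * b) 0 (≤-trans (≤-reflexive (+-identityʳ a)) a≤4b) (n<1+n (4 * b))
  where
  climb : ∀ fuel t → suc t * suc t * a ≤ 4 * b → 4 * b < suc t + fuel →
    ∃[ t′ ] (suc t′ * suc t′ * a ≤ 4 * b × b ≤ suc t′ * suc t′ * a)
  climb zero t sq lt = contradiction (≤-trans (subst (4 * b <_) (+-identityʳ (suc t)) lt)
    (≤-trans (m≤m*n (suc t) (suc t)) (≤-trans (m≤m*n (suc t * suc t) a {{>-nonZero 0<a}}) sq))) 1+n≰n
  climb (suc fuel) t sq lt with suc (suc t) * suc (suc t) * a ≤? 4 * b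
  ... | yes sq′ = climb fuel (suc t) sq′ (subst (4 * b <_) (cong suc (+-suc t fuel)) lt)
  -- At the largest s with s² a ≤ 4 b, failure at s + 1 ≤ 2 s yields b ≤ s² a.
  ... | no big = t , sq , *-cancelˡ-≤ 4 (≤-trans (<⇒≤ (≰⇒> big)) (begin
    suc (suc t) * suc (suc t) * a ≤⟨ *-monoˡ-≤ a (*-mono-≤ double double) ⟩
    2 * suc t * (2 * suc t) * a   ≡⟨ r₁ (suc t) a ⟩
    4 * (suc t * suc t * a) ∎))
    where
    open ≤-Reasoning
    double : suc (suc t) ≤ 2 * suc t
    double = s≤s (≤-trans (≤-reflexive (sym (+-comm t 1))) (+-monoʳ-≤ t (s≤s z≤n)))
    r₁ : ∀ s a → 2 * s * (2 * s) * a ≡ 4 * (s * s * a)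
    r₁ = solve-∀

-- In units of a n² the main term is at least 16/25 and the error at most 1/50, leaving 31/50, more
-- than a half.
dense-arithmetic : ∀ E a b n w x → 0 < E → 50 ≤ E → 4 * n ≤ 5 * w → w ≤ n →
  E * a * (w * w) ≤ E * b * x + a * n * w → a * (n * n) ≤ 2 * (b * x)
dense-arithmetic E a b n w x 0<E 50≤E large w≤n lower = *-cancelˡ-≤ (25 * E) {{>-nonZero (m*n>0 {25} z<s 0<E)}} (begin
  25 * E * (a * (n * n))  ≤⟨ *-monoˡ-≤ (a * (n * n)) (*-monoˡ-≤ E (m≤m+n 25 6)) ⟩
  31 * E * (a * (n * n))  ≤⟨ cancel-≤ (31 * E * (a * (n * n))) (25 * E * (2 * (b * x))) 
        (50 * (E * a * (w * w)) + 50 * (a * n * w) + 50 * (a * (n * n)) + E * (a * (n * n)))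
        (+-mono-≤ (+-mono-≤ (*-monoʳ-≤ (2 * (E * a)) (*-mono-≤ large large)) (*-monoʳ-≤ 50 lower))
          (+-mono-≤ (*-monoʳ-≤ (50 * (a * n)) w≤n) (*-monoˡ-≤ (a * (n * n)) 50≤E)))
        (r₁ E a n w) (r₂ E a b n w x) ⟩
  25 * E * (2 * (b * x)) ∎)
  where
  open ≤-Reasoning
  r₁ : ∀ E a n w → 2 * (E * a) * (4 * n * (4 * n)) + 50 * (E * a * (w * w)) + (50 * (a * n) * w + 50 * (a * (n * n)))
    ≡ 31 * E * (a * (n * n)) + (50 * (E * a * (w * w)) + 50 * (a * n * w) + 50 * (a * (n * n)) + E * (a * (n * n)))
  r₁ = solve-∀
  r₂ : ∀ E a b n w x → 2 * (E * a) * (5 * w * (5 * w)) + 50 * (E * b * x + a * n * w) + (50 * (a * n) * n + E * (a * (n * n)))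
    ≡ 25 * E * (2 * (b * x)) + (50 * (E * a * (w * w)) + 50 * (a * n * w) + 50 * (a * (n * n)) + E * (a * (n * n)))
  r₂ = solve-∀

module Phases {n : ℕ} (G : Graph n) (a b E h c : ℕ) (0<a : 0 < a) (0<b : 0 < b) (0<n : 0 < n) (50≤E : 50 ≤ E)
  (upper : ∀ X → E * b * Edges.e G X X ≤ E * a * (size X * size X) + a * n * size X)
  (lower : ∀ X → E * a * (size X * size X) ≤ E * b * Edges.e G X X + a * n * size X)
  (E≡12h : E ≡ 12 * h) (h≡80c : h ≡ 80 * c) (c≡ : c ≡ 4 * 10 * (2 * 10 + 1))
  (t : ℕ) (s²a≤4b : suc t * suc t * a ≤ 4 * b) (b≤s²a : b ≤ suc t * suc t * a)
  where
  open Regions G a b E h c 0<a 0<b 0<n 50≤E upper lower E≡12h h≡80c c≡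

  s : ℕ
  s = suc t

  0<c : 0 < c
  0<c = subst (0 <_) (sym c≡) z<s

  0<h : 0 < h
  0<h = ≤-trans (s≤s z≤n) 10≤h

  nb : Subset n → Subset n
  nb T y = some (λ x → T x ∧ adj G x y)

  short-of : ∀ k → b * k ≤ s * D → s * k ≤ 8 * n
  short-of k bk≤ = *-cancelˡ-≤ b {{>-nonZero 0<b}} (begin
    b * (s * k)          ≡⟨ r₁ b s k ⟩
    s * (b * k)          ≤⟨ *-monoʳ-≤ s bk≤ ⟩
    s * (s * (2 * a * n)) ≡⟨ r₂ s a n ⟩
    s * s * a * (2 * n)  ≤⟨ *-monoˡ-≤ (2 * n) s²a≤4b ⟩
    4 * b * (2 * n)      ≡⟨ r₃ b n ⟩
    b * (8 * n) ∎)
    where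
    open ≤-Reasoning
    r₁ : ∀ b s k → b * (s * k) ≡ s * (b * k)
    r₁ = solve-∀
    r₂ : ∀ s a n → s * (s * (2 * a * n)) ≡ s * s * a * (2 * n)
    r₂ = solve-∀
    r₃ : ∀ b n → 4 * b * (2 * n) ≡ b * (8 * n)
    r₃ = solve-∀

  nb-upper : ∀ T → T ⊆ ∁ heavy → size T ≤ s → b * size (nb T) ≤ s * D
  nb-upper T light T≤ = begin
    b * size (nb T)
      ≤⟨ *-monoʳ-≤ b (sum-mono (λ y → χ-some≤sum (λ x → T x ∧ adj G x y))) ⟩
    b * sum₂ (λ y x → χ (T x ∧ adj G x y)) ≡⟨ cong (b *_) (sum-swap (λ y x → χ (T x ∧ adj G x y))) ⟩
    b * sum₂ (λ x y → χ (T x ∧ adj G x y)) ≡⟨ sum-*ˡ b (λ x → sumFin n (λ y → χ (T x ∧ adj G x y))) ⟨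
    sumFin n (λ x → b * sumFin n (λ y → χ (T x ∧ adj G x y))) ≤⟨ sum-mono term ⟩
    sumFin n (λ x → χ (T x) * D)           ≡⟨ sum-*ʳ D (χ ∘ T) ⟩
    size T * D                             ≤⟨ *-monoˡ-≤ D T≤ ⟩
    s * D ∎
    where
    open ≤-Reasoning
    term : ∀ x → b * sumFin n (λ y → χ (T x ∧ adj G x y)) ≤ χ (T x) * D
    term x with T x in Tx
    ... | false = ≤-reflexive (trans (cong (b *_) (sum-zero n)) (*-zeroʳ b))
    ... | true  = ≤-trans (light-deg x (not-true (light x Tx))) (≤-reflexive (sym (*-identityˡ D)))

  -- The last field says |N(T)| ≥ s p n / (2 c), a constant fraction of the upper bound 2 s p n from
  -- `nb-upper`.
  record Broad (T : Subset n) : Set where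
    field
      conn  : ConnectedIn G T
      light : T ⊆ ∁ heavy
      small : size T ≤ s
      broad : s * (a * n) ≤ 2 * c * (b * size (nb T))
  open Broad

  -- The targets are the neighbourhoods of the vertices of W, and empty for other y. Their parts in
  -- W have total size e(W,W), at least p n² / 2, and every target met gives a neighbour of T.
  broad-set : ∀ {U} → Region U → ∃[ T ] (Broad T × T ⊆ ∁ U × size T ≤ s)
  broad-set {U} ρ = build (grow N t (λ y → short-of (size (N y)) (N-small y)))
    where
    open Region ρ using (W; avoids; large; grow) renaming (light to W-light)
    open ≤-Reasoning
    N : Fin n → Subset n
    N y x = W y ∧ adj G x y
    N-small : ∀ y → b * size (N y) ≤ s * D
    N-small y = ≤-trans one (m≤m+n D (t * D))
      where
      one : b * size (N y) ≤ D
      one with W y in Wy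
      ... | false = ≤-trans (≤-reflexive (trans (cong (b *_) (sum-zero n)) (*-zeroʳ b))) z≤n
      ... | true  = ≤-trans (≤-reflexive (cong (b *_) (sum-cong (λ x → cong χ (adj-sym G x y)))))
                      (light-deg y (not-true (W-light y Wy)))
    w = size W
    total : sumFin n (λ y → size (N y ∩ W)) ≡ e W W
    total = sum₂-cong term
      where
      term : ∀ y x → χ ((W y ∧ adj G x y) ∧ W x) ≡ χ (W y) * (χ (W x) * χ (adj G y x))
      term y x rewrite adj-sym G x y with W y | W x | adj G y x
      ... | false | _     | _     = refl
      ... | true  | true  | true  = refl
      ... | true  | true  | false = refl
      ... | true  | false | true  = refl
      ... | true  | false | false = refl
    dense : a * (n * n) ≤ 2 * (b * e W W)
    dense = dense-arithmetic E a b n w (e W W) 0<E 50≤E large (size≤n W) (lower W)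
    build : ∃[ T ] (ConnectedIn G T × T ⊆ W × size T ≤ suc t ×
      suc t * sumFin n (λ y → size (N y ∩ W)) ≤ c * n * sumFin n (λ y → χ (meets T (N y)))) → _
    build (T , conn , T⊆W , T≤ , hits) = T ,
      record { conn = conn ; light = λ x Tx → W-light x (T⊆W x Tx) ; small = T≤ ; broad = broad′ } ,
      (λ x Tx → avoids x (T⊆W x Tx)) , T≤
      where
      meets⇒nb : ∀ y → meets T (N y) ≡ true → nb T y ≡ true
      meets⇒nb y p = let x , q = some-elim (T ∩ N y) p
                         Tx , Nx = ∧-elim (T x) q
                     in some-intro (λ x → T x ∧ adj G x y) x (∧-intro Tx (proj₂ (∧-elim (W y) Nx)))
      broad′ : s * (a * n) ≤ 2 * c * (b * size (nb T))
      broad′ = *-cancelˡ-≤ n {{>-nonZero 0<n}} (begin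
        n * (s * (a * n))                ≡⟨ r₁ n s a ⟩
        s * (a * (n * n))                ≤⟨ *-monoʳ-≤ s dense ⟩
        s * (2 * (b * e W W))            ≡⟨ r₂ s b (e W W) ⟩
        2 * b * (s * e W W)              ≤⟨ *-monoʳ-≤ (2 * b) (≤-trans (≤-reflexive (cong (s *_) (sym total)))
                                              (≤-trans hits (*-monoʳ-≤ (c * n) (sum-mono (λ y → χ-mono (meets⇒nb y)))))) ⟩
        2 * b * (c * n * size (nb T))    ≡⟨ r₃ b c n (size (nb T)) ⟩
        n * (2 * c * (b * size (nb T))) ∎)
        where
        r₁ : ∀ n s a → n * (s * (a * n)) ≡ s * (a * (n * n))
        r₁ = solve-∀
        r₂ : ∀ s b x → s * (2 * (b * x)) ≡ 2 * b * (s * x)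
        r₂ = solve-∀
        r₃ : ∀ b c n v → 2 * b * (c * n * v) ≡ n * (2 * c * (b * v))
        r₃ = solve-∀

  module Second {m : ℕ} (B : Fin m → Subset n) (U₁ : Subset n) (Bs : ∀ i → Broad (B i))
    (cover : ∀ x → sumFin m (λ i → χ (B i x)) ≤ χ (U₁ x)) (n≤4hms : n ≤ 4 * h * (m * s))
    where

    hitcount : Subset n → ℕ
    hitcount T = sumFin m (λ i → χ (meets T (nb (B i))))

    Hub : Subset n → Set
    Hub T = ConnectedIn G T × m ≤ 4 * (c * c) * hitcount T

    hub : ∀ {U} → U₁ ⊆ U → Region U → ∃[ T ] (Hub T × T ⊆ ∁ U × size T ≤ s)
    hub {U} U₁⊆U ρ = build (grow (λ i → nb (B i)) t
        (λ i → short-of (size (nb (B i))) (nb-upper (B i) (light (Bs i)) (small (Bs i)))))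
      where
      open Region ρ using (W; avoids; cosmall; grow)
      open ≤-Reasoning
      S P F y : ℕ
      S = sumFin m (λ i → size (nb (B i)))
      P = sumFin m (λ i → size (nb (B i) ∩ W))
      F = e (∁ W) (∁ W)
      y = size (∁ W)
      -- A vertex of N(B i) outside W is charged to an edge joining it to B i. Both ends lie outside
      -- W, and the B i are disjoint, so F bounds all charges.
      S≤P+F : S ≤ P + F
      S≤P+F = begin
        S ≤⟨ sum₂-mono (λ i v → split (nb (B i) v) (W v)) ⟩
        sum₂ (λ i v → χ (nb (B i) v ∧ W v) + χ (nb (B i) v ∧ not (W v))) ≡⟨ sum₂-+ {m} {n} _ _ ⟩
        P + sum₂ (λ i v → χ (nb (B i) v ∧ not (W v))) ≤⟨ +-monoʳ-≤ P (sum₂-mono outside) ⟩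
        P + sum₂ (λ i v → sumFin n (λ x → χ (B i x) * (χ (not (W v)) * χ (adj G x v)))) ≡⟨ cong (P +_) regroup ⟩
        P + sum₂ (λ v x → sumFin m (λ i → χ (B i x)) * (χ (not (W v)) * χ (adj G x v)))
          ≤⟨ +-monoʳ-≤ P (sum₂-mono (λ v x → *-monoˡ-≤ (χ (not (W v)) * χ (adj G x v)) (≤-trans (cover x) (χ-mono (U₁⇒ x))))) ⟩
        P + sum₂ (λ v x → χ (not (W x)) * (χ (not (W v)) * χ (adj G x v)))
          ≡⟨ cong (P +_) (sum-swap (λ v x → χ (not (W x)) * (χ (not (W v)) * χ (adj G x v)))) ⟩
        P + F ∎
        where
        split : ∀ p q → χ p ≤ χ (p ∧ q) + χ (p ∧ not q)
        split false _ = z≤n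
        split true true = s≤s z≤n
        split true false = s≤s z≤n
        U₁⇒ : ∀ x → U₁ x ≡ true → not (W x) ≡ true
        U₁⇒ x U₁x with W x in Wx
        ... | false = refl
        ... | true = contradiction (trans (sym (U₁⊆U x U₁x)) (not-true (avoids x Wx))) λ ()
        outside : ∀ i v → χ (nb (B i) v ∧ not (W v)) ≤ sumFin n (λ x → χ (B i x) * (χ (not (W v)) * χ (adj G x v)))
        outside i v with W v
        ... | true  = ≤-trans (χ-mono {nb (B i) v ∧ false} {false} (λ p → proj₂ (∧-elim (nb (B i) v) p))) z≤n
        ... | false = ≤-trans (χ-mono {nb (B i) v ∧ true} {nb (B i) v} (λ p → proj₁ (∧-elim (nb (B i) v) p)))
          (≤-trans (χ-some≤sum (λ x → B i x ∧ adj G x v)) (sum-mono (λ x → ∧-* (B i x) (adj G x v))))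
          where
          ∧-* : ∀ p q → χ (p ∧ q) ≤ χ p * (1 * χ q)
          ∧-* false _ = z≤n
          ∧-* true true = ≤-refl
          ∧-* true false = z≤n
        regroup : sum₂ (λ i v → sumFin n (λ x → χ (B i x) * (χ (not (W v)) * χ (adj G x v))))
          ≡ sum₂ (λ v x → sumFin m (λ i → χ (B i x)) * (χ (not (W v)) * χ (adj G x v)))
        regroup = trans (sum-swap (λ i v → sumFin n (λ x → χ (B i x) * (χ (not (W v)) * χ (adj G x v)))))
          (sum-cong (λ v → trans (sum-swap (λ i x → χ (B i x) * (χ (not (W v)) * χ (adj G x v))))
            (sum-cong (λ x → sum-*ʳ (χ (not (W v)) * χ (adj G x v)) (λ i → χ (B i x))))))
      -- In units of p n² / h² the main term is at most 4 and the error at most 1/6, rounded up to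
      -- 5.
      few : h * h * (b * F) ≤ 5 * (a * (n * n))
      few = *-cancelˡ-≤ (12 * h) {{>-nonZero (m*n>0 {12} z<s 0<h)}} (begin
        12 * h * (h * h * (b * F))    ≡⟨ cong (_* (h * h * (b * F))) E≡12h ⟨
        E * (h * h * (b * F))         ≡⟨ r₁ E h b F ⟩
        h * h * (E * b * F)           ≤⟨ *-monoʳ-≤ (h * h) (upper (∁ W)) ⟩
        h * h * (E * a * (y * y) + a * n * y) ≡⟨ r₂ h E a y n ⟩
        E * a * (h * y * (h * y)) + a * n * h * (h * y)
          ≤⟨ +-mono-≤ (*-monoʳ-≤ (E * a) (*-mono-≤ cosmall cosmall)) (*-monoʳ-≤ (a * n * h) cosmall) ⟩
        E * a * (2 * n * (2 * n)) + a * n * h * (2 * n)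
          ≡⟨ cong (λ k → k * a * (2 * n * (2 * n)) + a * n * h * (2 * n)) E≡12h ⟩
        12 * h * a * (2 * n * (2 * n)) + a * n * h * (2 * n) ≤⟨ m≤m+n _ (10 * h * (a * (n * n))) ⟩
        12 * h * a * (2 * n * (2 * n)) + a * n * h * (2 * n) + 10 * h * (a * (n * n)) ≡⟨ r₃ h a n ⟩
        12 * h * (5 * (a * (n * n))) ∎)
        where
        r₁ : ∀ E h b F → E * (h * h * (b * F)) ≡ h * h * (E * b * F)
        r₁ = solve-∀
        r₂ : ∀ h E a y n → h * h * (E * a * (y * y) + a * n * y)
          ≡ E * a * (h * y * (h * y)) + a * n * h * (h * y)
        r₂ = solve-∀
        r₃ : ∀ h a n → 12 * h * a * (2 * n * (2 * n)) + a * n * h * (2 * n) + 10 * h * (a * (n * n))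
          ≡ 12 * h * (5 * (a * (n * n)))
        r₃ = solve-∀
      many : m * (s * (a * n)) ≤ 2 * c * (b * S)
      many = begin
        m * (s * (a * n)) ≡⟨ cong (_* (s * (a * n))) (sum-one m) ⟨
        sumFin m (λ _ → 1) * (s * (a * n)) ≡⟨ sum-*ʳ {m} (s * (a * n)) (λ _ → 1) ⟨
        sumFin m (λ _ → 1 * (s * (a * n)))
          ≤⟨ sum-mono (λ i → ≤-trans (≤-reflexive (*-identityˡ (s * (a * n)))) (broad (Bs i))) ⟩
        sumFin m (λ i → 2 * c * (b * size (nb (B i)))) ≡⟨ sum-*ˡ (2 * c) (λ i → b * size (nb (B i))) ⟩
        2 * c * sumFin m (λ i → b * size (nb (B i))) ≡⟨ cong (2 * c *_) (sum-*ˡ b (λ i → size (nb (B i)))) ⟩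
        2 * c * (b * S) ∎
      -- This is the origin of h = 80 c: F ≤ 5 p n² / h² by `few`, while `many` and n ≤ 4 h m s give
      -- S ≥ p n² / (8 c h).
      2F≤S : 2 * F ≤ S
      2F≤S = *-cancelˡ-≤ (40 * c * h * b) {{>-nonZero (m*n>0 (m*n>0 (m*n>0 {40} z<s 0<c) 0<h) 0<b)}} (begin
        40 * c * h * b * (2 * F)       ≡⟨ r₁ c h b F ⟩
        80 * c * h * (b * F)           ≡⟨ cong (λ k → k * h * (b * F)) h≡80c ⟨
        h * h * (b * F)                ≤⟨ few ⟩
        5 * (a * (n * n))              ≡⟨ r₂ a n ⟩
        5 * (a * n) * n                ≤⟨ *-monoʳ-≤ (5 * (a * n)) n≤4hms ⟩
        5 * (a * n) * (4 * h * (m * s)) ≡⟨ r₃ a n h m s ⟩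
        20 * h * (m * (s * (a * n)))   ≤⟨ *-monoʳ-≤ (20 * h) many ⟩
        20 * h * (2 * c * (b * S))     ≡⟨ r₄ h c b S ⟩
        40 * c * h * b * S ∎)
        where
        r₁ : ∀ c h b F → 40 * c * h * b * (2 * F) ≡ 80 * c * h * (b * F)
        r₁ = solve-∀
        r₂ : ∀ a n → 5 * (a * (n * n)) ≡ 5 * (a * n) * n
        r₂ = solve-∀
        r₃ : ∀ a n h m s → 5 * (a * n) * (4 * h * (m * s)) ≡ 20 * h * (m * (s * (a * n)))
        r₃ = solve-∀
        r₄ : ∀ h c b S → 20 * h * (2 * c * (b * S)) ≡ 40 * c * h * b * S
        r₄ = solve-∀
      S≤2P : S ≤ 2 * P
      S≤2P = cancel-≤ _ _ (S + 2 * F) (+-mono-≤ (*-monoʳ-≤ 2 S≤P+F) 2F≤S) (r₁ S F) (r₂ S P F)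
        where
        r₁ : ∀ S F → 2 * S + 2 * F ≡ S + (S + 2 * F)
        r₁ = solve-∀
        r₂ : ∀ S P F → 2 * (P + F) + S ≡ 2 * P + (S + 2 * F)
        r₂ = solve-∀
      build : ∃[ T ] (ConnectedIn G T × T ⊆ W × size T ≤ suc t × suc t * P ≤ c * n * hitcount T) →
        ∃[ T ] (Hub T × T ⊆ ∁ U × size T ≤ s)
      build (T , conn , T⊆W , T≤ , hits) = T , (conn , many-hits) , (λ x Tx → avoids x (T⊆W x Tx)) , T≤
        where
        -- Because s² p ≥ 1, s P is at least m n / (4 c), and `hits` credits each set met with c n.
        many-hits : m ≤ 4 * (c * c) * hitcount T
        many-hits = *-cancelˡ-≤ (b * n) {{>-nonZero (m*n>0 0<b 0<n)}} (begin
          b * n * m                         ≡⟨ r₁ b n m ⟩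
          n * m * b                         ≤⟨ *-monoʳ-≤ (n * m) b≤s²a ⟩
          n * m * (s * s * a)               ≡⟨ r₂ n m s a ⟩
          s * (m * (s * (a * n)))
            ≤⟨ *-monoʳ-≤ s (≤-trans many (*-monoʳ-≤ (2 * c) (*-monoʳ-≤ b S≤2P))) ⟩
          s * (2 * c * (b * (2 * P)))       ≡⟨ r₃ s c b P ⟩
          4 * c * b * (s * P)               ≤⟨ *-monoʳ-≤ (4 * c * b) hits ⟩
          4 * c * b * (c * n * hitcount T)  ≡⟨ r₄ c b n (hitcount T) ⟩
          b * n * (4 * (c * c) * hitcount T) ∎)
          where
          r₁ : ∀ b n m → b * n * m ≡ n * m * b
          r₁ = solve-∀
          r₂ : ∀ n m s a → n * m * (s * s * a) ≡ s * (m * (s * (a * n)))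
          r₂ = solve-∀
          r₃ : ∀ s c b P → s * (2 * c * (b * (2 * P))) ≡ 4 * c * b * (s * P)
          r₃ = solve-∀
          r₄ : ∀ c b n v → 4 * c * b * (c * n * v) ≡ b * n * (4 * (c * c) * v)
          r₄ = solve-∀

  -- With ε edges on 2 m vertices the average degree is ε / m ≥ m / (4 c²). Then m ≥ n / (4 h s) and
  -- s ≤ 2/√p give n √p / (32 h c²), stated in squared form.
  dense-minor : ∀ m → 0 < m → h * (2 * (m * s)) ≤ n → n ≤ 4 * h * (m * s) →
    ∃[ k ] ∃[ Γ ] (Σ (IsMinorOf {k} Γ G) λ _ → 0 < k ×
      a * (n * n) * (k * k) ≤ 8 * h * (4 * (c * c)) * (8 * h * (4 * (c * c))) * (b * (2 * eAll Γ * (2 * eAll Γ))))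
  dense-minor m 0<m room n≤ = conclude
    (pack h s Broad (λ _ → false) (λ U _ U≤ → broad-set (region U U≤)) m (λ _ → false) (λ _ p → p) room₁)
    where
    open ≤-Reasoning
    empty : size {n} (λ _ → false) ≡ 0
    empty = sum-zero n
    room₁ : h * (size {n} (λ _ → false) + m * s) ≤ n
    room₁ = ≤-trans (*-monoʳ-≤ h (≤-trans (≤-reflexive (cong (_+ m * s) empty)) (m≤m+n (m * s) _))) room
    conclude : _ → _
    conclude (B , U₁ , Bs , coverB , U₁≤) = finish
      (pack h s Hub U₁ (λ U U₁⊆U U≤ → hub U₁⊆U (region U U≤)) m U₁ (λ _ p → p) room₂)
      where
      open Second B U₁ Bs (λ x → ≤-trans (≤-reflexive (sym (+-identityʳ _))) (coverB x)) n≤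
      room₂ : h * (size U₁ + m * s) ≤ n
      room₂ = ≤-trans (*-monoʳ-≤ h (≤-trans (+-monoˡ-≤ (m * s) (≤-trans U₁≤ (≤-reflexive (cong (_+ m * s) empty))))
        (≤-reflexive (cong (m * s +_) (sym (+-identityʳ (m * s))))))) room
      finish : _ → _
      finish (C , U₂ , Cs , coverC , _) = m + m , quotient , quotient-minor , ≤-trans 0<m (m≤m+n m m) , count
        where
        packed : ∀ x → sumFin m (λ i → χ (B i x)) + sumFin m (λ j → χ (C j x)) ≤ 1
        packed x = begin
          sumFin m (λ i → χ (B i x)) + sumFin m (λ j → χ (C j x))
            ≤⟨ +-monoˡ-≤ _ (≤-trans (≤-reflexive (sym (+-identityʳ _))) (coverB x)) ⟩
          χ (U₁ x) + sumFin m (λ j → χ (C j x)) ≡⟨ +-comm (χ (U₁ x)) _ ⟩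
          sumFin m (λ j → χ (C j x)) + χ (U₁ x) ≤⟨ coverC x ⟩
          χ (U₂ x) ≤⟨ χ≤1 (U₂ x) ⟩
          1 ∎
        open Bipartite G B C (λ i → conn (Bs i)) (λ j → proj₁ (Cs j)) packed
        K₁ ε : ℕ
        K₁ = 4 * (c * c)
        ε = eAll quotient
        m²≤ : m * m ≤ K₁ * ε
        m²≤ = begin
          m * m                          ≡⟨ cong (_* m) (sum-one m) ⟨
          sumFin m (λ _ → 1) * m         ≡⟨ sum-*ʳ {m} m (λ _ → 1) ⟨
          sumFin m (λ _ → 1 * m)
            ≤⟨ sum-mono (λ j → ≤-trans (≤-reflexive (*-identityˡ m)) (proj₂ (Cs j))) ⟩
          sumFin m (λ j → K₁ * hitcount (C j)) ≡⟨ sum-*ˡ K₁ (λ j → hitcount (C j)) ⟩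
          K₁ * sumFin m (λ j → hitcount (C j)) ≡⟨ cong (K₁ *_) (sum-swap (λ j i → χ (meets (C j) (nb (B i))))) ⟩
          K₁ * sum₂ (λ i j → χ (meets (C j) (nb (B i)))) ≤⟨ *-monoʳ-≤ K₁ many-edges ⟩
          K₁ * ε ∎
        count : a * (n * n) * ((m + m) * (m + m)) ≤ 8 * h * K₁ * (8 * h * K₁) * (b * (2 * ε * (2 * ε)))
        count = begin
          a * (n * n) * ((m + m) * (m + m))
            ≤⟨ *-monoˡ-≤ ((m + m) * (m + m)) (*-monoʳ-≤ a (*-mono-≤ n≤ n≤)) ⟩
          a * (4 * h * (m * s) * (4 * h * (m * s))) * ((m + m) * (m + m)) ≡⟨ r₁ a h m s ⟩
          s * s * a * (64 * (h * h) * (m * m * (m * m)))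
            ≤⟨ *-mono-≤ s²a≤4b (*-monoʳ-≤ (64 * (h * h)) (*-mono-≤ m²≤ m²≤)) ⟩
          4 * b * (64 * (h * h) * (K₁ * ε * (K₁ * ε)))             ≡⟨ r₂ b h K₁ ε ⟩
          8 * h * K₁ * (8 * h * K₁) * (b * (2 * ε * (2 * ε))) ∎
          where
          r₁ : ∀ a h m s → a * (4 * h * (m * s) * (4 * h * (m * s))) * ((m + m) * (m + m))
            ≡ s * s * a * (64 * (h * h) * (m * m * (m * m)))
          r₁ = solve-∀
          r₂ : ∀ b h K e → 4 * b * (64 * (h * h) * (K * e * (K * e)))
            ≡ 8 * h * K * (8 * h * K) * (b * (2 * e * (2 * e)))
          r₂ = solve-∀

-- Rational arithmetic

toℚᵘ-ℕtoℚ : ∀ m → toℚᵘ (ℕtoℚ m) ℚᵘ.≃ mkℚᵘ (ℤ.+ m) 0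
toℚᵘ-ℕtoℚ m = ℚ.toℚᵘ-fromℚᵘ (mkℚᵘ (ℤ.+ m) 0)

ℕtoℚ-+ : ∀ m k → ℕtoℚ (m + k) ≡ ℕtoℚ m ℚ.+ ℕtoℚ k
ℕtoℚ-+ m k = ℚ.toℚᵘ-injective (ℚᵘ.≃-trans (toℚᵘ-ℕtoℚ (m + k)) (ℚᵘ.≃-trans
  (*≡* (cong (ℤ._* ℤ.+ 1) (cong₂ ℤ._+_ (sym (ℤ.*-identityʳ (ℤ.+ m))) (sym (ℤ.*-identityʳ (ℤ.+ k))))))
  (ℚᵘ.≃-sym (ℚᵘ.≃-trans (ℚ.toℚᵘ-homo-+ (ℕtoℚ m) (ℕtoℚ k)) (ℚᵘ.+-cong (toℚᵘ-ℕtoℚ m) (toℚᵘ-ℕtoℚ k))))))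

ℕtoℚ-* : ∀ m k → ℕtoℚ (m * k) ≡ ℕtoℚ m ℚ.* ℕtoℚ k
ℕtoℚ-* m k = ℚ.toℚᵘ-injective (ℚᵘ.≃-trans (toℚᵘ-ℕtoℚ (m * k)) (ℚᵘ.≃-trans
  (*≡* (cong (ℤ._* ℤ.+ 1) (ℤ.pos-* m k)))
  (ℚᵘ.≃-sym (ℚᵘ.≃-trans (ℚ.toℚᵘ-homo-* (ℕtoℚ m) (ℕtoℚ k)) (ℚᵘ.*-cong (toℚᵘ-ℕtoℚ m) (toℚᵘ-ℕtoℚ k))))))

ℕtoℚ-mono : ∀ {m k} → m ≤ k → ℕtoℚ m ℚ.≤ ℕtoℚ k
ℕtoℚ-mono {m} {k} m≤k = ℚ.toℚᵘ-cancel-≤ (ℚᵘ.≤-respˡ-≃ (ℚᵘ.≃-sym (toℚᵘ-ℕtoℚ m)) (ℚᵘ.≤-respʳ-≃ (ℚᵘ.≃-sym (toℚᵘ-ℕtoℚ k))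
  (*≤* (ℤ.*-monoʳ-≤-nonNeg (ℤ.+ 1) (ℤ.+≤+ m≤k)))))

ℕtoℚ-cancel : ∀ {m k} → ℕtoℚ m ℚ.≤ ℕtoℚ k → m ≤ k
ℕtoℚ-cancel {m} {k} le with ℚᵘ.≤-respˡ-≃ (toℚᵘ-ℕtoℚ m) (ℚᵘ.≤-respʳ-≃ (toℚᵘ-ℕtoℚ k) (ℚ.toℚᵘ-mono-≤ le))
... | *≤* p = ℤ.drop‿+≤+ (subst₂ ℤ._≤_ (ℤ.*-identityʳ (ℤ.+ m)) (ℤ.*-identityʳ (ℤ.+ k)) p)

ℕtoℚ-nonNeg : ∀ m → ℚ.NonNegative (ℕtoℚ m)
ℕtoℚ-nonNeg m = ℚ.nonNegative (ℕtoℚ-mono {0} {m} z≤n)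

ℕtoℚ-pos : ∀ {m} → 0 < m → ℚ.Positive (ℕtoℚ m)
ℕtoℚ-pos {suc m} _ = ℚ.normalize-pos (suc m) 1

fraction : ∀ {q} a d → toℚᵘ q ℚᵘ.≃ mkℚᵘ (ℤ.+ a) d → q ℚ.* ℕtoℚ (suc d) ≡ ℕtoℚ a
fraction {q} a d q≃ = ℚ.toℚᵘ-injective (ℚᵘ.≃-trans (ℚ.toℚᵘ-homo-* q (ℕtoℚ (suc d)))
  (ℚᵘ.≃-trans (ℚᵘ.*-cong q≃ (toℚᵘ-ℕtoℚ (suc d))) (ℚᵘ.≃-trans (*≡* cross-multiply) (ℚᵘ.≃-sym (toℚᵘ-ℕtoℚ a)))))
  where
  cross-multiply : ℤ.+ a ℤ.* ℤ.+ suc d ℤ.* ℤ.+ 1 ≡ ℤ.+ a ℤ.* ℤ.+ (suc d * 1)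
  cross-multiply = trans (ℤ.*-identityʳ _) (cong (λ k → ℤ.+ a ℤ.* ℤ.+ k) (sym (*-identityʳ (suc d))))

recip : ∀ F .{{_ : NonZero F}} → ℚ
recip F = ℤ.+ 1 ℚ./ F

recip-* : ∀ F .{{_ : NonZero F}} → recip F ℚ.* ℕtoℚ F ≡ 1ℚ
recip-* (suc k) = fraction 1 k (ℚ.toℚᵘ-fromℚᵘ (mkℚᵘ (ℤ.+ 1) k))

recip>0 : ∀ F .{{_ : NonZero F}} → 0ℚ ℚ.< recip F
recip>0 F = ℚ.positive⁻¹ (recip F) {{ℚ.normalize-pos 1 F}}

rational-cases : ∀ p → p ℚ.≤ 0ℚ ⊎ (∃[ a ] ∃[ b ] (0 < a × 0 < b × p ℚ.* ℕtoℚ b ≡ ℕtoℚ a))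
rational-cases (mkℚ (ℤ.+ suc a) d c) = inj₂ (suc a , suc d , z<s , z<s , fraction (suc a) d ℚᵘ.≃-refl)
rational-cases p@(mkℚ (ℤ.+ zero) d c) = inj₁ (ℚ.nonPositive⁻¹ p)
rational-cases p@(mkℚ -[1+ _ ] d c) = inj₁ (ℚ.nonPositive⁻¹ p)

p≤∣p∣ : ∀ p → p ℚ.≤ ℚ.∣ p ∣
p≤∣p∣ (mkℚ (ℤ.+ _) _ _)      = ℚ.≤-refl
p≤∣p∣ p@(mkℚ -[1+ _ ] _ _) = ℚ.≤-trans (ℚ.nonPositive⁻¹ p) (ℚ.0≤∣p∣ p)

∣-∣-bound : ∀ u v r → ℚ.∣ u ℚ.- v ∣ ℚ.≤ r → u ℚ.≤ r ℚ.+ v × v ℚ.≤ r ℚ.+ u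
∣-∣-bound u v r le =
  subst (ℚ._≤ r ℚ.+ v) (r₁ u v) (ℚ.+-monoˡ-≤ v (ℚ.≤-trans (p≤∣p∣ (u ℚ.- v)) le)) ,
  subst (ℚ._≤ r ℚ.+ u) (r₂ u v) (ℚ.+-monoˡ-≤ u
    (ℚ.≤-trans (p≤∣p∣ (ℚ.- (u ℚ.- v))) (subst (ℚ._≤ r) (sym (ℚ.∣-p∣≡∣p∣ (u ℚ.- v))) le)))
  where
  open +-*-Solver
  r₁ : ∀ u v → u ℚ.- v ℚ.+ v ≡ u
  r₁ = solve 2 (λ u v → u :- v :+ v := u) refl
  r₂ : ∀ u v → ℚ.- (u ℚ.- v) ℚ.+ u ≡ v
  r₂ = solve 2 (λ u v → :- (u :- v) :+ u := v) refl

clear-denominators : ∀ u v r k U V R .{{_ : ℚ.NonNegative k}} →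
  u ℚ.* k ≡ ℕtoℚ U → v ℚ.* k ≡ ℕtoℚ V → r ℚ.* k ≡ ℕtoℚ R → u ℚ.≤ r ℚ.+ v → U ≤ R + V
clear-denominators u v r k U V R uk vk rk le = ℕtoℚ-cancel {U} {R + V} (subst₂ ℚ._≤_ uk
  (trans (ℚ.*-distribʳ-+ k r v) (trans (cong₂ ℚ._+_ rk vk) (sym (ℕtoℚ-+ R V))))
  (ℚ.*-monoʳ-≤-nonNeg k le))

-- The number of branch sets and the return to rational densities

dense-minor-ℕ : ∀ {n} (G : Graph n) (a b E h c : ℕ) → 0 < a → 0 < b → 50 ≤ E →
  E ≡ 12 * h → h ≡ 80 * c → c ≡ 4 * 10 * (2 * 10 + 1) → 0 < n → 48 * (h * h) ≤ n →
  (∀ X → E * b * Edges.e G X X ≤ E * a * (size X * size X) + a * n * size X) →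
  (∀ X → E * a * (size X * size X) ≤ E * b * Edges.e G X X + a * n * size X) →
  ∃[ k ] ∃[ Γ ] (Σ (IsMinorOf {k} Γ G) λ _ → 0 < k ×
    a * (n * n) * (k * k) ≤ 8 * h * (4 * (c * c)) * (8 * h * (4 * (c * c))) * (b * (2 * eAll Γ * (2 * eAll Γ))))
dense-minor-ℕ {n} G a b E h c 0<a 0<b 50≤E E≡ h≡ c≡ 0<n n-large upper lower
  with integer-sqrt a b 0<a (≤-trans (Pseudorandom.a≤2b G a b E 0<a 0<b 0<n 50≤E upper lower) (*-monoˡ-≤ b (m≤m+n 2 2)))
... | t , s²a≤4b , b≤s²a = Phases.dense-minor G a b E h c 0<a 0<b 0<n 50≤E upper lower E≡ h≡ c≡ t s²a≤4b b≤s²a m 0<m room n≤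
  where
  open ≤-Reasoning
  s = suc t
  0<h : 0 < h
  0<h = subst (0 <_) (sym (trans h≡ (cong (80 *_) c≡))) z<s
  -- Both phases together use at most 2 m s vertices, which must not exceed n / h.
  q = 2 * h * s
  instance
    q≢0 : NonZero q
    q≢0 = >-nonZero (m*n>0 (m*n>0 {2} z<s 0<h) z<s)
  m = n / q
  s²≤12n : s * s ≤ 12 * n
  s²≤12n = *-cancelʳ-≤ (s * s) (12 * n) a {{>-nonZero 0<a}} (begin
    s * s * a          ≤⟨ s²a≤4b ⟩
    4 * b              ≤⟨ *-monoʳ-≤ 4 (Pseudorandom.b≤3an G a b E 0<a 0<b 0<n 50≤E upper lower) ⟩
    4 * (3 * (a * n))  ≡⟨ r₁ a n ⟩
    12 * n * a ∎)
    where
    r₁ : ∀ a n → 4 * (3 * (a * n)) ≡ 12 * n * a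
    r₁ = solve-∀
  q≤n : q ≤ n
  q≤n = ≮⇒≥ λ n<q → contradiction (*-mono-< n<q n<q) (≤⇒≯ (begin
    2 * h * s * (2 * h * s)   ≡⟨ r₁ h s ⟩
    4 * (h * h) * (s * s)     ≤⟨ *-monoʳ-≤ (4 * (h * h)) s²≤12n ⟩
    4 * (h * h) * (12 * n)    ≡⟨ r₂ h n ⟩
    48 * (h * h) * n          ≤⟨ *-monoˡ-≤ n n-large ⟩
    n * n ∎))
    where
    r₁ : ∀ h s → 2 * h * s * (2 * h * s) ≡ 4 * (h * h) * (s * s)
    r₁ = solve-∀
    r₂ : ∀ h n → 4 * (h * h) * (12 * n) ≡ 48 * (h * h) * n
    r₂ = solve-∀
  0<m : 0 < m
  0<m = m≥n⇒m/n>0 q≤n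
  room : h * (2 * (m * s)) ≤ n
  room = ≤-trans (≤-reflexive (r₁ h m s)) (m/n*n≤m n q)
    where
    r₁ : ∀ h m s → h * (2 * (m * s)) ≡ m * (2 * h * s)
    r₁ = solve-∀
  -- Since m ≥ 1, the remainder is below q ≤ m q, so rounding loses at most a factor of 2.
  n≤ : n ≤ 4 * h * (m * s)
  n≤ = begin
    n                  ≡⟨ m≡m%n+[m/n]*n n q ⟩
    n % q + m * q      ≤⟨ +-monoˡ-≤ (m * q) (≤-trans (<⇒≤ (m%n<n n q)) (m≤n*m q m {{>-nonZero 0<m}})) ⟩
    m * q + m * q      ≡⟨ r₁ h m s ⟩
    4 * h * (m * s) ∎
    where
    r₁ : ∀ h m s → m * (2 * h * s) + m * (2 * h * s) ≡ 4 * h * (m * s)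
    r₁ = solve-∀

module _ {n : ℕ} (G : Graph n) (p β ε : ℚ) (a b E : ℕ) (pb≡a : p ℚ.* ℕtoℚ b ≡ ℕtoℚ a)
  (ε2E≡1 : ε ℚ.* ℕtoℚ (2 * E) ≡ 1ℚ) (0≤p : 0ℚ ℚ.≤ p)
  (little : ℚ.∣ β ∣ ℚ.≤ ε ℚ.* ℚ.∣ ℕtoℚ n ℚ.* p ∣) (jumbled : Jumbled G p β) where

  private
    module _ (X : Subset n) where
      x = size X
      x̂ = ℕtoℚ x
      û = ℕtoℚ (eIn G X)
      v̂ = p ℚ.* x̂ ℚ.* x̂ ℚ.* ½
      r̂ = ε ℚ.* (ℕtoℚ n ℚ.* p) ℚ.* x̂
      -- Multiplying by 2 E b clears the denominators of p, ε and ½; its factor 2 turns edges into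
      -- ordered pairs.
      k̂ = ℕtoℚ (2 * E) ℚ.* ℕtoℚ b

      instance
        x̂-nonNeg : ℚ.NonNegative x̂
        x̂-nonNeg = ℕtoℚ-nonNeg x
        k̂-nonNeg : ℚ.NonNegative k̂
        k̂-nonNeg = subst ℚ.NonNegative (ℕtoℚ-* (2 * E) b) (ℕtoℚ-nonNeg (2 * E * b))

      0≤np : 0ℚ ℚ.≤ ℕtoℚ n ℚ.* p
      0≤np = subst (ℚ._≤ ℕtoℚ n ℚ.* p) (ℚ.*-zeroʳ (ℕtoℚ n)) (ℚ.*-monoˡ-≤-nonNeg (ℕtoℚ n) {{ℕtoℚ-nonNeg n}} 0≤p)

      deviation : ℚ.∣ û ℚ.- v̂ ∣ ℚ.≤ r̂
      deviation = ℚ.≤-trans (jumbled X) (ℚ.*-monoʳ-≤-nonNeg x̂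
        (ℚ.≤-trans (p≤∣p∣ β) (subst (λ z → ℚ.∣ β ∣ ℚ.≤ ε ℚ.* z) (ℚ.0≤p⇒∣p∣≡p 0≤np) little)))

      û-scaled : û ℚ.* k̂ ≡ ℕtoℚ (eIn G X * (2 * E * b))
      û-scaled = trans (cong (û ℚ.*_) (sym (ℕtoℚ-* (2 * E) b))) (sym (ℕtoℚ-* (eIn G X) (2 * E * b)))

      v̂-scaled : v̂ ℚ.* k̂ ≡ ℕtoℚ (a * (E * (x * x)))
      v̂-scaled = trans (cong (λ z → v̂ ℚ.* (z ℚ.* ℕtoℚ b)) (ℕtoℚ-* 2 E))
        (trans (r₁ p x̂ ½ (ℕtoℚ 2) (ℕtoℚ E) (ℕtoℚ b))
          (trans (cong (λ z → z ℚ.* (½ ℚ.* ℕtoℚ 2) ℚ.* (ℕtoℚ E ℚ.* (x̂ ℚ.* x̂))) pb≡a)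
            (trans (cong (ℚ._* (ℕtoℚ E ℚ.* (x̂ ℚ.* x̂))) (ℚ.*-identityʳ (ℕtoℚ a)))
              (sym (trans (ℕtoℚ-* a _) (cong (ℕtoℚ a ℚ.*_) (trans (ℕtoℚ-* E _) (cong (ℕtoℚ E ℚ.*_) (ℕtoℚ-* x x)))))))))
        where
        open +-*-Solver
        r₁ : ∀ p x h t E b → p ℚ.* x ℚ.* x ℚ.* h ℚ.* (t ℚ.* E ℚ.* b)
          ≡ p ℚ.* b ℚ.* (h ℚ.* t) ℚ.* (E ℚ.* (x ℚ.* x))
        r₁ = solve 6 (λ p x h t E b → p :* x :* x :* h :* (t :* E :* b) := p :* b :* (h :* t) :* (E :* (x :* x))) refl

      r̂-scaled : r̂ ℚ.* k̂ ≡ ℕtoℚ (a * (n * x))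
      r̂-scaled = trans (r₁ ε (ℕtoℚ n) p x̂ (ℕtoℚ (2 * E)) (ℕtoℚ b))
        (trans (cong₂ (λ y z → y ℚ.* z ℚ.* (ℕtoℚ n ℚ.* x̂)) ε2E≡1 pb≡a)
          (trans (cong (ℚ._* (ℕtoℚ n ℚ.* x̂)) (ℚ.*-identityˡ (ℕtoℚ a)))
            (sym (trans (ℕtoℚ-* a _) (cong (ℕtoℚ a ℚ.*_) (ℕtoℚ-* n x))))))
        where
        open +-*-Solver
        r₁ : ∀ e n p x F b → e ℚ.* (n ℚ.* p) ℚ.* x ℚ.* (F ℚ.* b) ≡ e ℚ.* F ℚ.* (p ℚ.* b) ℚ.* (n ℚ.* x)
        r₁ = solve 6 (λ e n p x F b → e :* (n :* p) :* x :* (F :* b) := e :* F :* (p :* b) :* (n :* x)) refl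

  ordered-pairs : ∀ X → eIn G X * (2 * E * b) ≡ E * b * Edges.e G X X
  ordered-pairs X = trans (r₁ (eIn G X) E b) (cong (E * b *_) (Edges.2*eIn≡e G X))
    where
    r₁ : ∀ u E b → u * (2 * E * b) ≡ E * b * (2 * u)
    r₁ = solve-∀

  jumbled-upper : ∀ X → E * b * Edges.e G X X ≤ E * a * (size X * size X) + a * n * size X
  jumbled-upper X = subst₂ _≤_ (ordered-pairs X) (r₁ a n (size X) E)
    (clear-denominators (û X) (v̂ X) (r̂ X) (k̂ X) (eIn G X * (2 * E * b)) (a * (E * (size X * size X))) (a * (n * size X))
      {{k̂-nonNeg X}} (û-scaled X) (v̂-scaled X) (r̂-scaled X)
      (proj₁ (∣-∣-bound (û X) (v̂ X) (r̂ X) (deviation X))))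
    where
    r₁ : ∀ a n x E → a * (n * x) + a * (E * (x * x)) ≡ E * a * (x * x) + a * n * x
    r₁ = solve-∀

  jumbled-lower : ∀ X → E * a * (size X * size X) ≤ E * b * Edges.e G X X + a * n * size X
  jumbled-lower X = subst₂ _≤_ (r₁ a (size X) E)
    (trans (r₂ a n (size X) (eIn G X * (2 * E * b))) (cong (_+ a * n * size X) (ordered-pairs X)))
    (clear-denominators (v̂ X) (û X) (r̂ X) (k̂ X) (a * (E * (size X * size X))) (eIn G X * (2 * E * b)) (a * (n * size X))
      {{k̂-nonNeg X}} (v̂-scaled X) (û-scaled X) (r̂-scaled X)
      (proj₂ (∣-∣-bound (û X) (v̂ X) (r̂ X) (deviation X))))
    where
    r₁ : ∀ a x E → a * (E * (x * x)) ≡ E * a * (x * x)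
    r₁ = solve-∀
    r₂ : ∀ a n x u → a * (n * x) + u ≡ u + a * n * x
    r₂ = solve-∀

density-ℚ : ∀ n k e a b K (c p : ℚ) → 0 < b → 0 < K → c ℚ.* ℕtoℚ K ≡ 1ℚ → p ℚ.* ℕtoℚ b ≡ ℕtoℚ a →
  a * (n * n) * (k * k) ≤ K * K * (b * (e * e)) →
  c ℚ.* c ℚ.* ℕtoℚ n ℚ.* ℕtoℚ n ℚ.* p ℚ.* ℕtoℚ k ℚ.* ℕtoℚ k ℚ.≤ ℕtoℚ e ℚ.* ℕtoℚ e
density-ℚ n k e a b K c p 0<b 0<K cK≡1 pb≡a le =
  ℚ.*-cancelʳ-≤-pos (ℕtoℚ (K * K * b)) {{ℕtoℚ-pos (m*n>0 (m*n>0 0<K 0<K) 0<b)}} (subst₂ ℚ._≤_ (sym left) (sym right)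
    (ℕtoℚ-mono {a * (n * n) * (k * k)} {K * K * (b * (e * e))} le))
  where
  open +-*-Solver
  n̂ = ℕtoℚ n
  k̂ = ℕtoℚ k
  ê = ℕtoℚ e
  K̂ = ℕtoℚ K
  scale : ℕtoℚ (K * K * b) ≡ K̂ ℚ.* K̂ ℚ.* ℕtoℚ b
  scale = trans (ℕtoℚ-* (K * K) b) (cong (ℚ._* ℕtoℚ b) (ℕtoℚ-* K K))
  left : c ℚ.* c ℚ.* n̂ ℚ.* n̂ ℚ.* p ℚ.* k̂ ℚ.* k̂ ℚ.* ℕtoℚ (K * K * b) ≡ ℕtoℚ (a * (n * n) * (k * k))
  left = trans (cong (c ℚ.* c ℚ.* n̂ ℚ.* n̂ ℚ.* p ℚ.* k̂ ℚ.* k̂ ℚ.*_) scale)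
    (trans (r₁ c n̂ p k̂ K̂ (ℕtoℚ b))
      (trans (cong₂ (λ y z → y ℚ.* y ℚ.* (z ℚ.* (n̂ ℚ.* n̂) ℚ.* (k̂ ℚ.* k̂))) cK≡1 pb≡a)
        (trans (ℚ.*-identityˡ _)
          (sym (trans (ℕtoℚ-* (a * (n * n)) (k * k))
            (cong₂ ℚ._*_ (trans (ℕtoℚ-* a (n * n)) (cong (ℕtoℚ a ℚ.*_) (ℕtoℚ-* n n))) (ℕtoℚ-* k k)))))))
    where
    r₁ : ∀ c n p k K b → c ℚ.* c ℚ.* n ℚ.* n ℚ.* p ℚ.* k ℚ.* k ℚ.* (K ℚ.* K ℚ.* b)
      ≡ c ℚ.* K ℚ.* (c ℚ.* K) ℚ.* (p ℚ.* b ℚ.* (n ℚ.* n) ℚ.* (k ℚ.* k))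
    r₁ = solve 6 (λ c n p k K b → c :* c :* n :* n :* p :* k :* k :* (K :* K :* b)
      := c :* K :* (c :* K) :* (p :* b :* (n :* n) :* (k :* k))) refl
  right : ê ℚ.* ê ℚ.* ℕtoℚ (K * K * b) ≡ ℕtoℚ (K * K * (b * (e * e)))
  right = trans (cong (ℚ._* ℕtoℚ (K * K * b)) (sym (ℕtoℚ-* e e)))
    (trans (sym (ℕtoℚ-* (e * e) (K * K * b))) (cong ℕtoℚ (r₁ e K b)))
    where
    r₁ : ∀ e K b → e * e * (K * K * b) ≡ K * K * (b * (e * e))
    r₁ = solve-∀

-- For p ≤ 0 the left side of the density inequality is a square times p, hence at most 0, and a
-- single vertex suffices.
trivial-minor : ∀ {n} (G : Graph n) → 0 < n → ∀ c p → p ℚ.≤ 0ℚ → HasDenseMinor G c p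
trivial-minor {suc n} G _ c p p≤0 = 1 , point , minor , z<s ,
  subst (ℚ._≤ 0ℚ) (sym (r₁ c (ℕtoℚ (suc n)) p (ℕtoℚ 1))) bound
  where
  open +-*-Solver
  x̂ = c ℚ.* ℕtoℚ (suc n) ℚ.* ℕtoℚ 1
  r₁ : ∀ c n p k → c ℚ.* c ℚ.* n ℚ.* n ℚ.* p ℚ.* k ℚ.* k ≡ c ℚ.* n ℚ.* k ℚ.* (c ℚ.* n ℚ.* k) ℚ.* p
  r₁ = solve 4 (λ c n p k → c :* c :* n :* n :* p :* k :* k := c :* n :* k :* (c :* n :* k) :* p) refl
  square-nonNeg : ∀ q → ℚ.NonNegative (q ℚ.* q)
  square-nonNeg q = subst ℚ.NonNegative (trans (ℚ.∣p*q∣≡∣p∣*∣q∣ q q) ∣q∣²) (ℚ.∣-∣-nonNeg (q ℚ.* q))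
    where
    ∣q∣² : ℚ.∣ q ∣ ℚ.* ℚ.∣ q ∣ ≡ q ℚ.* q
    ∣q∣² with ℚ.∣p∣≡p∨∣p∣≡-p q
    ... | inj₁ eq = cong₂ ℚ._*_ eq eq
    ... | inj₂ eq = trans (cong₂ ℚ._*_ eq eq) (solve 1 (λ q → (:- q) :* (:- q) := q :* q) refl q)
  bound : x̂ ℚ.* x̂ ℚ.* p ℚ.≤ 0ℚ
  bound = subst (x̂ ℚ.* x̂ ℚ.* p ℚ.≤_) (ℚ.*-zeroʳ (x̂ ℚ.* x̂)) (ℚ.*-monoˡ-≤-nonNeg (x̂ ℚ.* x̂) {{square-nonNeg x̂}} p≤0)
  point : Graph 1
  point = record { adj = λ _ _ → false ; sym = λ _ _ → refl ; irrefl = λ _ → refl }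
  minor : IsMinorOf point G
  minor = record
    { B = λ _ → ⁅ zero ⁆
    ; connected = λ _ → (zero , refl) , λ { zero zero _ _ → here refl }
    ; disjoint = λ { zero zero _ _ _ → refl }
    ; edges = λ _ _ ()
    }

-- The constants are variables tied by equations, so that their large values appear only at the
-- final instantiation.
jumbled-dense-minor : ∀ E h c K .{{_ : NonZero (2 * E)}} .{{_ : NonZero K}} → 50 ≤ E → 0 < K →
  E ≡ 12 * h → h ≡ 80 * c → c ≡ 4 * 10 * (2 * 10 + 1) → K ≡ 8 * h * (4 * (c * c)) →
  ∀ (p β : ℕ → ℚ) → LittleO β p → ∃[ N ] ∀ n → N ≤ n → (G : Graph n) → Jumbled G (p n) (β n) →
    HasDenseMinor G (recip K) (p n)
-- N₀ ensures |β| ≤ n |p| / (2 E), 48 h² leaves room for at least one branch set per phase, and the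
-- successor makes n positive.
jumbled-dense-minor E h c K 50≤E 0<K E≡ h≡ c≡ K≡ p β β≪np = N₀ + suc (48 * (h * h)) , dense
  where
  threshold = β≪np (recip (2 * E)) (recip>0 (2 * E))
  N₀ = proj₁ threshold
  dense : ∀ n → N₀ + suc (48 * (h * h)) ≤ n → (G : Graph n) → Jumbled G (p n) (β n) → HasDenseMinor G (recip K) (p n)
  dense n n-large G jumbled = cases (rational-cases (p n))
    where
    0<n : 0 < n
    0<n = m<n⇒0<n (m+n≤o⇒n≤o N₀ n-large)
    cases : p n ℚ.≤ 0ℚ ⊎ (∃[ a ] ∃[ b ] (0 < a × 0 < b × p n ℚ.* ℕtoℚ b ≡ ℕtoℚ a)) → HasDenseMinor G (recip K) (p n)
    cases (inj₁ p≤0) = trivial-minor G 0<n (recip K) (p n) p≤0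
    cases (inj₂ (a , b , 0<a , 0<b , pb≡a)) = convert
      (dense-minor-ℕ G a b E h c 0<a 0<b 50≤E E≡ h≡ c≡ 0<n (<⇒≤ (m+n≤o⇒n≤o N₀ n-large))
        (jumbled-upper G (p n) (β n) ε a b E pb≡a ε2E≡1 0≤p little jumbled)
        (jumbled-lower G (p n) (β n) ε a b E pb≡a ε2E≡1 0≤p little jumbled))
      where
      ε = recip (2 * E)
      ε2E≡1 = recip-* (2 * E)
      little = proj₂ threshold n (m+n≤o⇒m≤o N₀ n-large)
      0≤p : 0ℚ ℚ.≤ p n
      0≤p = ℚ.*-cancelʳ-≤-pos (ℕtoℚ b) {{ℕtoℚ-pos 0<b}}
        (subst₂ ℚ._≤_ (sym (ℚ.*-zeroˡ (ℕtoℚ b))) (sym pb≡a) (ℕtoℚ-mono {0} {a} z≤n))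
      convert : ∃[ k ] ∃[ Γ ] (Σ (IsMinorOf {k} Γ G) λ _ → 0 < k ×
        a * (n * n) * (k * k) ≤ 8 * h * (4 * (c * c)) * (8 * h * (4 * (c * c))) * (b * (2 * eAll Γ * (2 * eAll Γ)))) →
        HasDenseMinor G (recip K) (p n)
      convert (k , Γ , minor , 0<k , count) = k , Γ , minor , 0<k ,
        density-ℚ n k (2 * eAll Γ) a b K (recip K) (p n) 0<b 0<K (recip-* K) pb≡a
          (subst (λ z → a * (n * n) * (k * k) ≤ z * z * (b * (2 * eAll Γ * (2 * eAll Γ)))) (sym K≡) count)

theorem4p4 : ∃[ c ] (0ℚ ℚ.< c × (∀ (p β : ℕ → ℚ) → LittleO β p →
                 ∃[ N ] ∀ (n : ℕ) → N ≤ n → (G : Graph n) → Jumbled G (p n) (β n) →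
                   HasDenseMinor G c (p n)))
theorem4p4 = recip K , recip>0 K ,
  -- 50 + 806350 is 12 · 80 · 840, the value of E.
  jumbled-dense-minor (12 * h) h c K (m≤m+n 50 806350) z<s refl refl refl refl
  where
  c = 840
  h = 80 * c
  K = 8 * h * (4 * (c * c))
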